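{- Let $r_1,r_2\ge 1$, let $G_1$ and $G_2$ be regular subgroups of $\mathrm{GA}(r_1,2)$ and $\mathrm{GA}(r_2,2)$ respectively, and let $T$ and $S$ be automorphisms of the groups $G_1$ and $G_2$ respectively. Let $\tau$ and $\sigma$ be the permutations (of $F^{r_1}$ and $F^{r_2}$) induced by $T$ and $S$, with distensions $l_1$ and $l_2$ and deficiencies $k_1$ and $k_2$ respectively. Then $S_{\mathcal H,\tau|\sigma}$ is a propelinear extended perfect code of length $2^{r_1+r_2+1}$ with $$\mathrm{rank}(S_{\mathcal H,\tau|\sigma})=2^{r_1+r_2+1}-r_1-r_2-2+l_1+l_2$$ and $$\dim(\mathrm{Ker}(S_{\mathcal H,\tau|\sigma}))=2^{r_1+r_2+1}-r_1-r_2-2-k_1-k_2.$$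
   Context: $F=\mathrm{GF}(2)$; $F^n$ carries the Hamming metric; a code of length $n$ is a set of vectors of $F^n$, whose elements are called codewords. $\mathrm{wt}$ is Hamming weight. ${\bf 0}$ denotes the all-zero vector; $x|y$ denotes concatenation. A code $C\subseteq F^n$ is perfect if for every $x\in F^n$ there is exactly one $y\in C$ at Hamming distance at most $1$ from $x$. An extended perfect code is obtained from a perfect code by adding an overall parity check coordinate to all codewords (its position is immaterial). The rank of a code is the dimension of its linear span over $F$. The kernel $\mathrm{Ker}(C)$ of a code $C$ of length $n$ is the set of all $x\in F^n$ with $x+C=C$ (a linear subspace). $\mathrm{Aut}(F^n)$ is the group of all transformations $(x,\pi)$, $x\in F^n$, $\pi$ a permutation of the coordinate positions, acting by $(x,\pi)(y)=x+\pi(y)$ where $\pi(y)=(y_{\pi^{ -1}(1)},\ldots,y_{\pi^{ -1}(n)})$. $\mathrm{Aut}(C)$ is the setwise stabilizer of $C$ in $\mathrm{Aut}(F^n)$. A group acting on a set is regular if it acts transitively and its order equals the size of the set. A code $C$ is propelinear if $\mathrm{Aut}(C)$ has a subgroup acting regularly on the codewords of $C$. For each $r\ge1$: the coordinates of $F^{2^r}$ are indexed by the vectors of $F^r$; $e_a$ is the vector whose only nonzero coordinate is the one indexed by $a$; $\mathcal H=\{c\in F^{2^r}:\sum_{a:c_a=1}a={\bf 0},\ \mathrm{wt}(c)\equiv 0 \pmod 2\}$ and $\mathcal H_a=\mathcal H+e_a+e_{\bf 0}$. For a bijection $\rho:F^r\to F^r$, $S_{\mathcal H,\rho}=\bigcup_{a\in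 F^r}\mathcal H_a\times\mathcal H_{\rho(a)}$, where $C\times D=\{x|y:x\in C,y\in D\}$. In $S_{\mathcal H,\tau|\sigma}$ one takes $r=r_1+r_2$ and $\tau|\sigma:F^{r_1+r_2}\to F^{r_1+r_2}$, $(\tau|\sigma)(x|y)=\tau(x)|\sigma(y)$ for $x\in F^{r_1}$, $y\in F^{r_2}$. For a bijection $\rho:F^r\to F^r$ with $\rho({\bf 0})={\bf 0}$: $\rho$ acts on $x\in F^{2^r}$ by permuting coordinates, $\rho(x)_b=x_{\rho^{ -1}(b)}$, and the distension of $\rho$ is $2^r-r-1-\dim(\mathcal H\cap\rho(\mathcal H))$. For nonzero $a\in F^r$, $\mathrm{Star}(a)=\{\{a,b,a+b\}:b\in F^r\setminus\{{\bf 0},a\}\}$ and $\rho(\mathrm{Star}(a))=\{\{\rho(a),\rho(b),\rho(a+b)\}:b\in F^r\setminus\{{\bf 0},a\}\}$; the number of nonzero $a$ with $\rho(\mathrm{Star}(a))=\mathrm{Star}(\rho(a))$ is always a power of two minus one, and the deficiency of $\rho$ is $r-\log_2\left(|\{a\in F^r\setminus\{{\bf 0}\}:\rho(\mathrm{Star}(a))=\mathrm{Star}(\rho(a))\}|+1\right)$. $\mathrm{GA}(r,2)=\{(a,M):a\in F^r,\ M\in\mathrm{GL}(r,2)\}$ is the general affine group, acting on $F^r$ by $(a,M)(b)=a+Mb$, with composition as group operation. A subgroup $G$ of $\mathrm{GA}(r,2)$ is regular if it acts regularly on the vectors of $F^r$. For such $G$ and $a\in F^r$, $g_a$ denotes the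 unique element of $G$ mapping ${\bf 0}$ to $a$. The permutation $\tau$ of $F^r$ induced by an automorphism $T$ of the group $G$ is defined by $T(g_a)=g_{\tau(a)}$ for all $a\in F^r$ (in particular $\tau({\bf 0})={\bf 0}$). -}

module Defs where

open import Algebra.Bundles using (Group)
open import Algebra.Morphism.Structures using (module GroupMorphisms)
open import Data.Bool using (Bool; true; false; _xor_; _∧_)
open import Data.Bool.Properties using (xor-assoc; xor-comm; xor-identityˡ; xor-identityʳ; xor-same; ∧-distribˡ-xor; ∧-assoc; ∧-zeroʳ)
import Data.Bool.Properties as Bool
open import Data.Fin using (Fin; zero; suc; combine; remQuot)
open import Data.Fin.Permutation as Perm using (Permutation′; _⟨$⟩ʳ_; _⟨$⟩ˡ_; _∘ₚ_)
open import Data.Fin.Properties using (2↔Bool; remQuot-combine; combine-remQuot)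
open import Data.Fin.Subset using (Subset; ⁅_⁆; _∪_)
open import Data.Integer as ℤ using (ℤ; +_)
open import Data.Nat using (ℕ; zero; suc; _+_; _^_; _≤_)
open import Data.Nat.Divisibility using (_∣_)
open import Data.Nat.Logarithm using (⌊log₂_⌋)
open import Data.Product using (Σ; ∃; ∃₂; ∃!; ∃-syntax; _×_; _,_; proj₁; proj₂)
open import Data.Vec using (Vec; []; _∷_; _++_; map; zipWith; replicate; tabulate; lookup; count; take; drop; insertAt; cast; _[_]≔_)
open import Data.Vec.Properties using (zipWith-assoc; zipWith-comm; zipWith-identityˡ; zipWith-identityʳ; lookup-zipWith; lookup∘tabulate; tabulate∘lookup; tabulate-∘; tabulate-cong; map-∘; map-cong; map-id; lookup-replicate; take++drop≡id; ++-injective)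
open import Data.Vec.Relation.Unary.All using (All)
open import Function using (_∘_; _↔_; Inverse; mk↔ₛ′)
open import Function.Construct.Composition using (_↔-∘_)
open import Function.Construct.Symmetry using (↔-sym)
open import Level using (Level; _⊔_; 0ℓ) renaming (suc to lsuc)
open import Relation.Binary using (Setoid)
import Relation.Binary.Construct.On as On
open import Relation.Binary.PropositionalEquality using (_≡_; _≢_; refl; sym; trans; cong; cong₂; subst; setoid; module ≡-Reasoning)
open import Relation.Unary using (Pred; _∩_; _≐_)

private
  variable
    a b c ℓ p : Level
    m n r : ℕ

HasSize : Setoid a ℓ → ℕ → Set (a ⊔ ℓ)
HasSize X n = Inverse X (setoid (Fin n))

SubsetSetoid : {A : Set a} → Pred A p → Setoid (a ⊔ p) a
SubsetSetoid {A = A} P = On.setoid {B = ∃ P} (setoid A) proj₁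

record Subgroup (G : Group c ℓ) : Set (lsuc c ⊔ ℓ) where
  open Group G
  field
    member    : Pred Carrier c
    resp-≈    : ∀ {g h} → g ≈ h → member g → member h
    ε-closed  : member ε
    ∙-closed  : ∀ {g h} → member g → member h → member (g ∙ h)
    ⁻¹-closed : ∀ {g} → member g → member (g ⁻¹)

  group : Group c ℓ
  group = record
    { Carrier = ∃ member
    ; _≈_     = λ g h → proj₁ g ≈ proj₁ h
    ; _∙_     = λ (g , g∈) (h , h∈) → g ∙ h , ∙-closed g∈ h∈
    ; ε       = ε , ε-closed
    ; _⁻¹     = λ (g , g∈) → g ⁻¹ , ⁻¹-closed g∈
    ; isGroup = record
      { isMonoid = record
        { isSemigroup = record
          { isMagma = record
            { isEquivalence = On.isEquivalence proj₁ isEquivalence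
            ; ∙-cong        = ∙-cong
            }
          ; assoc = λ g h k → assoc (proj₁ g) (proj₁ h) (proj₁ k)
          }
        ; identity = (λ g → identityˡ (proj₁ g)) , (λ g → identityʳ (proj₁ g))
        }
      ; inverse = (λ g → inverseˡ (proj₁ g)) , (λ g → inverseʳ (proj₁ g))
      ; ⁻¹-cong = ⁻¹-cong
      }
    }

record Action (G : Group c ℓ) (X : Setoid a b) : Set (a ⊔ b ⊔ c ⊔ ℓ) where
  open Group G using (Carrier; _∙_; ε) renaming (_≈_ to _≈ᴳ_)
  open Setoid X using (_≈_) renaming (Carrier to Point)
  infixr 6 _▷_
  field
    _▷_      : Carrier → Point → Point
    ▷-cong   : ∀ {g h x y} → g ≈ᴳ h → x ≈ y → g ▷ x ≈ h ▷ y
    identity : ∀ x → ε ▷ x ≈ x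
    compat   : ∀ g h x → (g ∙ h) ▷ x ≈ g ▷ (h ▷ x)

restrict : {G : Group c ℓ} {X : Setoid a b} → Action G X → (K : Subgroup G) → Action (Subgroup.group K) X
restrict act K = record
  { _▷_      = λ g x → proj₁ g ▷ x
  ; ▷-cong   = ▷-cong
  ; identity = identity
  ; compat   = λ g h → compat (proj₁ g) (proj₁ h)
  }
  where open Action act

record Regular {G : Group c ℓ} {X : Setoid a b} (act : Action G X) : Set (a ⊔ b ⊔ c ⊔ ℓ) where
  open Action act
  open Setoid X
  field
    transitive : ∀ x y → ∃[ g ] g ▷ x ≈ y
    order≡size : ∃[ n ] HasSize (Group.setoid G) n × HasSize X n

record Automorphism (G : Group c ℓ) : Set (c ⊔ ℓ) where
  open Group G
  field
    ⟦_⟧                : Carrier → Carrier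
    isGroupIsomorphism : GroupMorphisms.IsGroupIsomorphism rawGroup rawGroup ⟦_⟧

module _ {G : Group 0ℓ 0ℓ} {A : Set} (act : Action G (setoid A)) where
  open Group G using (Carrier; _⁻¹; inverseˡ; inverseʳ)
  open Action act renaming (identity to ▷-identity)

  image : Carrier → Pred A 0ℓ → Pred A 0ℓ
  image g C y = ∃[ x ] C x × g ▷ x ≡ y

  private
    g▷g⁻¹▷ : ∀ g x → g ▷ g ⁻¹ ▷ x ≡ x
    g▷g⁻¹▷ g x = trans (sym (compat g (g ⁻¹) x)) (trans (▷-cong (inverseʳ g) refl) (▷-identity x))

    g⁻¹▷g▷ : ∀ g x → g ⁻¹ ▷ g ▷ x ≡ x
    g⁻¹▷g▷ g x = trans (sym (compat (g ⁻¹) g x)) (trans (▷-cong (inverseˡ g) refl) (▷-identity x))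

  stabilizer : Pred A 0ℓ → Subgroup G
  stabilizer C = record
    { member    = λ g → image g C ≐ C
    ; resp-≈    = λ {g} {h} g≈h (⊆C , C⊆) →
        (λ (x , x∈ , eq) → ⊆C (x , x∈ , trans (▷-cong g≈h refl) eq)) ,
        (λ y∈ → let x , x∈ , eq = C⊆ y∈ in x , x∈ , trans (▷-cong (Group.sym G g≈h) refl) eq)
    ; ε-closed  =
        (λ (x , x∈ , eq) → subst C (trans (sym (▷-identity x)) eq) x∈) ,
        (λ {y} y∈ → y , y∈ , ▷-identity y)
    ; ∙-closed  = λ {g} {h} (g⊆ , ⊆g) (h⊆ , ⊆h) →
        (λ (x , x∈ , eq) → g⊆ (h ▷ x , h⊆ (x , x∈ , refl) , trans (sym (compat g h x)) eq)) ,
        (λ y∈ → let z , z∈ , eq  = ⊆g y∈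
                    x , x∈ , eq′ = ⊆h z∈
                in x , x∈ , trans (compat g h x) (trans (cong (g ▷_) eq′) eq))
    ; ⁻¹-closed = λ {g} (g⊆ , ⊆g) →
        (λ (x , x∈ , eq) → let z , z∈ , eq′ = ⊆g x∈ in
          subst C (trans (sym (g⁻¹▷g▷ g z)) (trans (cong (g ⁻¹ ▷_) eq′) eq)) z∈) ,
        (λ {y} y∈ → g ▷ y , g⊆ (y , y∈ , refl) , g⁻¹▷g▷ g y)
    }

  stabilizerAction : (C : Pred A 0ℓ) → Action (Subgroup.group (stabilizer C)) (SubsetSetoid C)
  stabilizerAction C = record
    { _▷_      = λ (g , g⊆ , _) (x , x∈) → g ▷ x , g⊆ (x , x∈ , refl)
    ; ▷-cong   = ▷-cong
    ; identity = λ x → ▷-identity (proj₁ x)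
    ; compat   = λ g h x → compat (proj₁ g) (proj₁ h) (proj₁ x)
    }

-- The field GF(2) is Bool with _xor_ as addition and _∧_ as multiplication.
F^ : ℕ → Set
F^ n = Vec Bool n

infixl 6 _⊕_
_⊕_ : F^ n → F^ n → F^ n
_⊕_ = zipWith _xor_

𝟎 : F^ n
𝟎 = replicate _ false

infixr 7 _⋆_
_⋆_ : Bool → F^ n → F^ n
s ⋆ x = map (s ∧_) x

-- The linear combination of the given vectors with coefficients x; this
-- is also the product of x by the matrix with the given columns.
infixr 7 _·_
_·_ : Vec (F^ m) n → F^ n → F^ m
[]       · []      = 𝟎
(v ∷ vs) · (s ∷ x) = s ⋆ v ⊕ vs · x

unit : Fin n → F^ n
unit i = 𝟎 [ i ]≔ true

wt : F^ n → ℕ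
wt = count (Bool._≟ true)

distance : F^ n → F^ n → ℕ
distance x y = wt (x ⊕ y)

⊕-assoc : (x y z : F^ n) → (x ⊕ y) ⊕ z ≡ x ⊕ (y ⊕ z)
⊕-assoc = zipWith-assoc xor-assoc

⊕-comm : (x y : F^ n) → x ⊕ y ≡ y ⊕ x
⊕-comm = zipWith-comm xor-comm

⊕-identityˡ : (x : F^ n) → 𝟎 ⊕ x ≡ x
⊕-identityˡ = zipWith-identityˡ xor-identityˡ

⊕-identityʳ : (x : F^ n) → x ⊕ 𝟎 ≡ x
⊕-identityʳ = zipWith-identityʳ xor-identityʳ

⊕-same : (x : F^ n) → x ⊕ x ≡ 𝟎
⊕-same []      = refl
⊕-same (s ∷ x) = cong₂ _∷_ (xor-same s) (⊕-same x)

⊕-interchange : (w x y z : F^ n) → (w ⊕ x) ⊕ (y ⊕ z) ≡ (w ⊕ y) ⊕ (x ⊕ z)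
⊕-interchange w x y z = begin
  (w ⊕ x) ⊕ (y ⊕ z)  ≡⟨ ⊕-assoc w x (y ⊕ z) ⟩
  w ⊕ (x ⊕ (y ⊕ z))  ≡⟨ cong (w ⊕_) (⊕-assoc x y z) ⟨
  w ⊕ ((x ⊕ y) ⊕ z)  ≡⟨ cong (λ t → w ⊕ (t ⊕ z)) (⊕-comm x y) ⟩
  w ⊕ ((y ⊕ x) ⊕ z)  ≡⟨ cong (w ⊕_) (⊕-assoc y x z) ⟩
  w ⊕ (y ⊕ (x ⊕ z))  ≡⟨ ⊕-assoc w y (x ⊕ z) ⟨
  (w ⊕ y) ⊕ (x ⊕ z)  ∎
  where open ≡-Reasoning

⋆-distribˡ-⊕ : ∀ s (x y : F^ n) → s ⋆ (x ⊕ y) ≡ s ⋆ x ⊕ s ⋆ y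
⋆-distribˡ-⊕ s []      []      = refl
⋆-distribˡ-⊕ s (t ∷ x) (u ∷ y) = cong₂ _∷_ (∧-distribˡ-xor s t u) (⋆-distribˡ-⊕ s x y)

⋆-distribʳ-⊕ : ∀ s t (x : F^ n) → (s xor t) ⋆ x ≡ s ⋆ x ⊕ t ⋆ x
⋆-distribʳ-⊕ s t []      = refl
⋆-distribʳ-⊕ s t (u ∷ x) = cong₂ _∷_ (Bool.∧-distribʳ-xor u s t) (⋆-distribʳ-⊕ s t x)

⋆-assoc : ∀ s t (x : F^ n) → (s ∧ t) ⋆ x ≡ s ⋆ t ⋆ x
⋆-assoc s t []      = refl
⋆-assoc s t (u ∷ x) = cong₂ _∷_ (∧-assoc s t u) (⋆-assoc s t x)

⋆-zeroˡ : (x : F^ n) → false ⋆ x ≡ 𝟎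
⋆-zeroˡ []      = refl
⋆-zeroˡ (_ ∷ x) = cong (false ∷_) (⋆-zeroˡ x)

⋆-zeroʳ : ∀ s → s ⋆ 𝟎 {n} ≡ 𝟎
⋆-zeroʳ {zero}  s = refl
⋆-zeroʳ {suc n} s = cong₂ _∷_ (∧-zeroʳ s) (⋆-zeroʳ s)

·-zero : (vs : Vec (F^ m) n) → vs · 𝟎 ≡ 𝟎
·-zero []       = refl
·-zero (v ∷ vs) = trans (cong₂ _⊕_ (⋆-zeroˡ v) (·-zero vs)) (⊕-identityˡ 𝟎)

·-⊕ : (vs : Vec (F^ m) n) (x y : F^ n) → vs · (x ⊕ y) ≡ vs · x ⊕ vs · y
·-⊕ []       []      []      = sym (⊕-identityˡ 𝟎)
·-⊕ (v ∷ vs) (s ∷ x) (t ∷ y) = trans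
  (cong₂ _⊕_ (⋆-distribʳ-⊕ s t v) (·-⊕ vs x y))
  (⊕-interchange (s ⋆ v) (t ⋆ v) (vs · x) (vs · y))

·-⋆ : (vs : Vec (F^ m) n) (s : Bool) (x : F^ n) → vs · s ⋆ x ≡ s ⋆ vs · x
·-⋆ []       s []      = sym (⋆-zeroʳ s)
·-⋆ (v ∷ vs) s (t ∷ x) = trans
  (cong₂ _⊕_ (⋆-assoc s t v) (·-⋆ vs s x))
  (sym (⋆-distribˡ-⊕ s (t ⋆ v) (vs · x)))

·-unit : (vs : Vec (F^ m) n) (i : Fin n) → vs · unit i ≡ lookup vs i
·-unit (v ∷ vs) zero    = trans (cong₂ _⊕_ (map-id v) (·-zero vs)) (⊕-identityʳ v)
·-unit (v ∷ vs) (suc i) = trans (cong₂ _⊕_ (⋆-zeroˡ v) (·-unit vs i)) (⊕-identityˡ _)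

LinearlyIndependent : Vec (F^ n) m → Set
LinearlyIndependent vs = ∀ x → vs · x ≡ 𝟎 → x ≡ 𝟎

-- The second component makes V the span of vs, so only subspaces have a
-- dimension.
HasDimension : Pred (F^ n) 0ℓ → ℕ → Set
HasDimension {n} V d =
  Σ (Vec (F^ n) d) λ vs → LinearlyIndependent vs × V ≐ (λ v → ∃[ x ] vs · x ≡ v)

Span : Pred (F^ n) 0ℓ → Pred (F^ n) 0ℓ
Span {n} C v = ∃[ k ] Σ (Vec (F^ n) k) λ vs → All C vs × ∃[ x ] vs · x ≡ v

Code : ℕ → Set₁
Code n = Pred (F^ n) 0ℓ

codeLength : Code n → ℕ
codeLength {n} _ = n

Perfect : Code n → Set
Perfect C = ∀ x → ∃! _≡_ λ y → C y × distance x y ≤ 1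

parity : F^ n → Bool
parity []      = false
parity (s ∷ x) = s xor parity x

addParity : Fin (suc n) → Code n → Code (suc n)
addParity i C x = ∃[ y ] C y × insertAt y i (parity y) ≡ x

ExtendedPerfect : Code n → Set₁
ExtendedPerfect {n} C =
  ∃[ m ] Σ (Code m) λ D → Σ (suc m ≡ n) λ eq → ∃[ i ]
    Perfect D × C ≐ (λ x → ∃[ y ] addParity i D y × cast eq y ≡ x)

HasRank : Code n → ℕ → Set
HasRank C = HasDimension (Span C)

infixr 6 _⊕ᶜ_
_⊕ᶜ_ : F^ n → Code n → Code n
(x ⊕ᶜ C) z = ∃[ y ] C y × x ⊕ y ≡ z

Ker : Code n → Code n
Ker C x = x ⊕ᶜ C ≐ C

infixr 5 _×ᶜ_
_×ᶜ_ : Code m → Code n → Code (m + n)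
(C ×ᶜ D) z = ∃₂ λ x y → C x × D y × x ++ y ≡ z

permute : Permutation′ n → F^ n → F^ n
permute π y = tabulate λ i → lookup y (π ⟨$⟩ˡ i)

private
  lookup-permute : (π : Permutation′ n) (y : F^ n) (i : Fin n) → lookup (permute π y) i ≡ lookup y (π ⟨$⟩ˡ i)
  lookup-permute π y = lookup∘tabulate _

  ext : {x y : F^ n} → (∀ i → lookup x i ≡ lookup y i) → x ≡ y
  ext {x = x} {y} eq = trans (sym (tabulate∘lookup x)) (trans (tabulate-cong eq) (tabulate∘lookup y))

  from-cong : {π ρ : Permutation′ n} → π Perm.≈ ρ → ∀ i → π ⟨$⟩ˡ i ≡ ρ ⟨$⟩ˡ i
  from-cong {π = π} {ρ} eq i = begin
    π ⟨$⟩ˡ i                      ≡⟨ cong (π ⟨$⟩ˡ_) (Perm.inverseʳ ρ) ⟨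
    π ⟨$⟩ˡ (ρ ⟨$⟩ʳ (ρ ⟨$⟩ˡ i))    ≡⟨ cong (π ⟨$⟩ˡ_) (eq (ρ ⟨$⟩ˡ i)) ⟨
    π ⟨$⟩ˡ (π ⟨$⟩ʳ (ρ ⟨$⟩ˡ i))    ≡⟨ Perm.inverseˡ π ⟩
    ρ ⟨$⟩ˡ i                      ∎
    where open ≡-Reasoning

permute-cong : {π ρ : Permutation′ n} → π Perm.≈ ρ → ∀ y → permute π y ≡ permute ρ y
permute-cong {π = π} {ρ} eq y = tabulate-cong λ i → cong (lookup y) (from-cong {π = π} {ρ} eq i)

permute-⊕ : (π : Permutation′ n) (x y : F^ n) → permute π (x ⊕ y) ≡ permute π x ⊕ permute π y
permute-⊕ π x y = ext λ i → begin
  lookup (permute π (x ⊕ y)) i                                 ≡⟨ lookup-permute π (x ⊕ y) i ⟩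
  lookup (x ⊕ y) (π ⟨$⟩ˡ i)                                    ≡⟨ lookup-zipWith _xor_ (π ⟨$⟩ˡ i) x y ⟩
  lookup x (π ⟨$⟩ˡ i) xor lookup y (π ⟨$⟩ˡ i)                  ≡⟨ cong₂ _xor_ (lookup-permute π x i) (lookup-permute π y i) ⟨
  lookup (permute π x) i xor lookup (permute π y) i            ≡⟨ lookup-zipWith _xor_ i (permute π x) (permute π y) ⟨
  lookup (permute π x ⊕ permute π y) i                         ∎
  where open ≡-Reasoning

permute-∘ : (π ρ : Permutation′ n) (y : F^ n) → permute (ρ ∘ₚ π) y ≡ permute π (permute ρ y)
permute-∘ π ρ y = tabulate-cong λ i → sym (lookup-permute ρ y (π ⟨$⟩ˡ i))

permute-id : (y : F^ n) → permute Perm.id y ≡ y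
permute-id = tabulate∘lookup

permute-𝟎 : (π : Permutation′ n) → permute π 𝟎 ≡ 𝟎
permute-𝟎 π = ext λ i → trans (lookup-permute π 𝟎 i)
  (trans (lookup-replicate (π ⟨$⟩ˡ i) false) (sym (lookup-replicate i false)))

-- _∘ₚ_ composes in diagrammatic order, so πρ is ρ ∘ₚ π.
AutF : ℕ → Group 0ℓ 0ℓ
AutF n = record
  { Carrier = F^ n × Permutation′ n
  ; _≈_     = λ (x , π) (y , ρ) → x ≡ y × π Perm.≈ ρ
  ; _∙_     = λ (x , π) (y , ρ) → x ⊕ permute π y , ρ ∘ₚ π
  ; ε       = 𝟎 , Perm.id
  ; _⁻¹     = λ (x , π) → permute (Perm.flip π) x , Perm.flip π
  ; isGroup = record
    { isMonoid = record
      { isSemigroup = record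
        { isMagma = record
          { isEquivalence = record
            { refl  = refl , λ _ → refl
            ; sym   = λ (p , q) → sym p , λ i → sym (q i)
            ; trans = λ (p , q) (p′ , q′) → trans p p′ , λ i → trans (q i) (q′ i)
            }
          ; ∙-cong = λ {(x , π)} {(x′ , π′)} {(y , ρ)} {(y′ , ρ′)} (p , q) (p′ , q′) →
              cong₂ _⊕_ p (trans (permute-cong {π = π} {π′} q y) (cong (permute π′) p′)) ,
              λ i → trans (q (ρ ⟨$⟩ʳ i)) (cong (π′ ⟨$⟩ʳ_) (q′ i))
          }
        ; assoc = λ (x , π) (y , ρ) (z , σ) →
            trans (⊕-assoc x (permute π y) (permute (ρ ∘ₚ π) z))
              (cong (x ⊕_) (trans (cong (permute π y ⊕_) (permute-∘ π ρ z))
                                  (sym (permute-⊕ π y (permute ρ z))))) ,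
            λ _ → refl
        }
      ; identity =
          (λ (x , π) → trans (⊕-identityˡ _) (permute-id x) , λ _ → refl) ,
          (λ (x , π) → trans (cong (x ⊕_) (permute-𝟎 π)) (⊕-identityʳ x) , λ _ → refl)
      }
    ; inverse =
        (λ (x , π) → ⊕-same (permute (Perm.flip π) x) , λ _ → Perm.inverseˡ π) ,
        (λ (x , π) →
          trans (cong (x ⊕_) (trans (sym (permute-∘ π (Perm.flip π) x))
                  (trans (permute-cong {π = Perm.flip π ∘ₚ π} {Perm.id} (λ _ → Perm.inverseʳ π) x) (permute-id x))))
                (⊕-same x) ,
          λ _ → Perm.inverseʳ π)
    ; ⁻¹-cong = λ {(x , π)} {(y , ρ)} (p , q) →
        trans (permute-cong {π = Perm.flip π} {Perm.flip ρ} (from-cong {π = π} {ρ} q) x) (cong (permute (Perm.flip ρ)) p) ,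
        from-cong {π = π} {ρ} q
    }
  }

autFAction : ∀ n → Action (AutF n) (setoid (F^ n))
autFAction n = record
  { _▷_      = λ (x , π) y → x ⊕ permute π y
  ; ▷-cong   = λ {(x , π)} {(x′ , ρ)} {y} (p , q) p′ →
      cong₂ _⊕_ p (trans (permute-cong {π = π} {ρ} q y) (cong (permute ρ) p′))
  ; identity = λ y → trans (⊕-identityˡ _) (permute-id y)
  ; compat   = λ (x , π) (y , ρ) z →
      trans (⊕-assoc x (permute π y) (permute (ρ ∘ₚ π) z))
        (cong (x ⊕_) (trans (cong (permute π y ⊕_) (permute-∘ π ρ z))
                            (sym (permute-⊕ π y (permute ρ z)))))
  }

Aut : Code n → Subgroup (AutF n)
Aut {n} = stabilizer (autFAction n)

Propelinear : Code n → Set₁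
Propelinear {n} C =
  Σ (Subgroup (Subgroup.group (Aut C))) λ K → Regular (restrict (stabilizerAction (autFAction n) C) K)

-- Square matrices are given by their columns.
Matrix : ℕ → Set
Matrix r = Vec (F^ r) r

I : Matrix r
I = tabulate unit

infixl 7 _⊗_
_⊗_ : Matrix r → Matrix r → Matrix r
M ⊗ N = map (M ·_) N

record GL (r : ℕ) : Set where
  field
    matrix   : Matrix r
    inverse  : Matrix r
    inverseˡ : inverse ⊗ matrix ≡ I
    inverseʳ : matrix ⊗ inverse ≡ I

open GL using (matrix)

map-·-· : (M : Vec (F^ m) r) (N : Vec (F^ r) n) (x : F^ n) → map (M ·_) N · x ≡ M · N · x
map-·-· M []      []      = sym (·-zero M)
map-·-· M (v ∷ N) (s ∷ x) = trans
  (cong₂ _⊕_ (sym (·-⋆ M s v)) (map-·-· M N x))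
  (sym (·-⊕ M (s ⋆ v) (N · x)))

I-· : (x : F^ n) → I · x ≡ x
I-· {zero}  []      = refl
I-· {suc n} (s ∷ x) = begin
  s ⋆ (true ∷ 𝟎) ⊕ tabulate (λ i → false ∷ unit i) · x
    ≡⟨ cong₂ (λ u vs → (s ∧ true ∷ u) ⊕ vs · x) (⋆-zeroʳ s) (tabulate-∘ (false ∷_) unit) ⟩
  (s ∧ true ∷ 𝟎) ⊕ map (false ∷_) I · x
    ≡⟨ cong ((s ∧ true ∷ 𝟎) ⊕_) (shift I x) ⟩
  ((s ∧ true) xor false) ∷ (𝟎 ⊕ I · x)
    ≡⟨ cong₂ _∷_ (trans (xor-identityʳ _) (Bool.∧-identityʳ s)) (trans (⊕-identityˡ _) (I-· x)) ⟩
  s ∷ x ∎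
  where
  open ≡-Reasoning
  shift : (vs : Vec (F^ m) r) (y : F^ r) → map (false ∷_) vs · y ≡ false ∷ vs · y
  shift []       []      = refl
  shift (v ∷ vs) (t ∷ y) = trans
    (cong ((t ∧ false ∷ t ⋆ v) ⊕_) (shift vs y))
    (cong (_∷ (t ⋆ v ⊕ vs · y)) (trans (xor-identityʳ _) (∧-zeroʳ t)))

⊗-assoc : (L M N : Matrix r) → (L ⊗ M) ⊗ N ≡ L ⊗ (M ⊗ N)
⊗-assoc L M N = trans (map-cong (map-·-· L M) N) (map-∘ (L ·_) (M ·_) N)

⊗-identityˡ : (M : Matrix r) → I ⊗ M ≡ M
⊗-identityˡ M = trans (map-cong I-· M) (map-id M)

⊗-identityʳ : (M : Matrix r) → M ⊗ I ≡ M
⊗-identityʳ M = begin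
  map (M ·_) (tabulate unit)     ≡⟨ tabulate-∘ (M ·_) unit ⟨
  tabulate (λ i → M · unit i)    ≡⟨ tabulate-cong (·-unit M) ⟩
  tabulate (lookup M)            ≡⟨ tabulate∘lookup M ⟩
  M                              ∎
  where open ≡-Reasoning

private
  cancel : (K L M N : Matrix r) → K ⊗ N ≡ I → L ⊗ M ≡ I → (K ⊗ L) ⊗ (M ⊗ N) ≡ I
  cancel K L M N KN LM = begin
    (K ⊗ L) ⊗ (M ⊗ N)  ≡⟨ ⊗-assoc K L (M ⊗ N) ⟩
    K ⊗ (L ⊗ (M ⊗ N))  ≡⟨ cong (K ⊗_) (⊗-assoc L M N) ⟨
    K ⊗ ((L ⊗ M) ⊗ N)  ≡⟨ cong (λ t → K ⊗ (t ⊗ N)) LM ⟩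
    K ⊗ (I ⊗ N)        ≡⟨ cong (K ⊗_) (⊗-identityˡ N) ⟩
    K ⊗ N              ≡⟨ KN ⟩
    I                  ∎
    where open ≡-Reasoning

GL-id : GL r
GL-id = record { matrix = I ; inverse = I ; inverseˡ = ⊗-identityˡ I ; inverseʳ = ⊗-identityˡ I }

GL-mul : GL r → GL r → GL r
GL-mul M N = record
  { matrix   = M.matrix ⊗ N.matrix
  ; inverse  = N.inverse ⊗ M.inverse
  ; inverseˡ = cancel N.inverse M.inverse M.matrix N.matrix N.inverseˡ M.inverseˡ
  ; inverseʳ = cancel M.matrix N.matrix N.inverse M.inverse M.inverseʳ N.inverseʳ
  }
  where
  module M = GL M
  module N = GL N

GL-inv : GL r → GL r
GL-inv M = record { matrix = M.inverse ; inverse = M.matrix ; inverseˡ = M.inverseʳ ; inverseʳ = M.inverseˡ }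
  where module M = GL M

private
  inverse-unique : (M N : GL r) → matrix M ≡ matrix N → GL.inverse M ≡ GL.inverse N
  inverse-unique M N eq = begin
    M.inverse                               ≡⟨ ⊗-identityʳ M.inverse ⟨
    M.inverse ⊗ I                           ≡⟨ cong (M.inverse ⊗_) N.inverseʳ ⟨
    M.inverse ⊗ (N.matrix ⊗ N.inverse)      ≡⟨ ⊗-assoc M.inverse N.matrix N.inverse ⟨
    (M.inverse ⊗ N.matrix) ⊗ N.inverse      ≡⟨ cong (λ t → (M.inverse ⊗ t) ⊗ N.inverse) eq ⟨
    (M.inverse ⊗ M.matrix) ⊗ N.inverse      ≡⟨ cong (_⊗ N.inverse) M.inverseˡ ⟩
    I ⊗ N.inverse                           ≡⟨ ⊗-identityˡ N.inverse ⟩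
    N.inverse                               ∎
    where
    open ≡-Reasoning
    module M = GL M
    module N = GL N

  affine-compat : (a b x : F^ r) (M N : Matrix r) → (a ⊕ M · b) ⊕ (M ⊗ N) · x ≡ a ⊕ M · (b ⊕ N · x)
  affine-compat a b x M N = begin
    (a ⊕ M · b) ⊕ (M ⊗ N) · x  ≡⟨ ⊕-assoc a (M · b) ((M ⊗ N) · x) ⟩
    a ⊕ (M · b ⊕ (M ⊗ N) · x)  ≡⟨ cong (λ t → a ⊕ (M · b ⊕ t)) (map-·-· M N x) ⟩
    a ⊕ (M · b ⊕ M · N · x)    ≡⟨ cong (a ⊕_) (·-⊕ M b (N · x)) ⟨
    a ⊕ M · (b ⊕ N · x)        ∎
    where open ≡-Reasoning

GA : ℕ → Group 0ℓ 0ℓ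
GA r = record
  { Carrier = F^ r × GL r
  ; _≈_     = λ (a , M) (b , N) → a ≡ b × matrix M ≡ matrix N
  ; _∙_     = λ (a , M) (b , N) → a ⊕ matrix M · b , GL-mul M N
  ; ε       = 𝟎 , GL-id
  ; _⁻¹     = λ (a , M) → GL.inverse M · a , GL-inv M
  ; isGroup = record
    { isMonoid = record
      { isSemigroup = record
        { isMagma = record
          { isEquivalence = record
            { refl  = refl , refl
            ; sym   = λ (p , q) → sym p , sym q
            ; trans = λ (p , q) (p′ , q′) → trans p p′ , trans q q′
            }
          ; ∙-cong = λ (p , q) (p′ , q′) → cong₂ _⊕_ p (cong₂ _·_ q p′) , cong₂ _⊗_ q q′
          }
        ; assoc = λ (a , L) (b , M) (c , N) →
            affine-compat a b c (matrix L) (matrix M) , ⊗-assoc (matrix L) (matrix M) (matrix N)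
        }
      ; identity =
          (λ (a , M) → trans (⊕-identityˡ _) (I-· a) , ⊗-identityˡ (matrix M)) ,
          (λ (a , M) → trans (cong (a ⊕_) (·-zero (matrix M))) (⊕-identityʳ a) , ⊗-identityʳ (matrix M))
      }
    ; inverse =
        (λ (a , M) → ⊕-same _ , GL.inverseˡ M) ,
        (λ (a , M) →
          trans (cong (a ⊕_) (trans (sym (map-·-· (matrix M) (GL.inverse M) a))
                  (trans (cong (_· a) (GL.inverseʳ M)) (I-· a))))
                (⊕-same a) ,
          GL.inverseʳ M)
    ; ⁻¹-cong = λ {(a , M)} {(b , N)} (p , q) →
        cong₂ _·_ (inverse-unique M N q) p , inverse-unique M N q
    }
  }

affineAction : ∀ r → Action (GA r) (setoid (F^ r))
affineAction r = record
  { _▷_      = λ (a , M) b → a ⊕ matrix M · b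
  ; ▷-cong   = λ (p , q) p′ → cong₂ _⊕_ p (cong₂ _·_ q p′)
  ; identity = λ x → trans (⊕-identityˡ _) (I-· x)
  ; compat   = λ (a , M) (b , N) x → affine-compat a b x (matrix M) (matrix N)
  }

RegularSubgroup : Subgroup (GA r) → Set
RegularSubgroup {r} G = Regular (restrict (affineAction r) G)

-- The element g_a of G with g_a(𝟎) = a. It is unique up to _≈_, because
-- G is transitive and has exactly as many elements as F^ r.
element : (G : Subgroup (GA r)) → RegularSubgroup G → F^ r → Group.Carrier (Subgroup.group G)
element G reg a = proj₁ (Regular.transitive reg 𝟎 a)

Induces : (G : Subgroup (GA r)) → RegularSubgroup G → Automorphism (Subgroup.group G) → (F^ r ↔ F^ r) → Set
Induces {r} G reg T τ = ∀ a → T.⟦ g a ⟧ ≈ g (Inverse.to τ a)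
  where
  open Group (Subgroup.group G) using (_≈_)
  module T = Automorphism T
  g = element G reg

-- Coordinates of F^ (2 ^ r) are indexed by F^ r through binary expansion.
index : F^ r → Fin (2 ^ r)
index []              = zero
index {suc r} (s ∷ a) = combine (Inverse.from 2↔Bool s) (index a)

vector : ∀ r → Fin (2 ^ r) → F^ r
vector zero    _ = []
vector (suc r) i = let s , j = remQuot {2} (2 ^ r) i in Inverse.to 2↔Bool s ∷ vector r j

index-vector : (i : Fin (2 ^ r)) → index (vector r i) ≡ i
index-vector {zero}  zero = refl
index-vector {suc r} i    = let s , j = remQuot {2} (2 ^ r) i in trans
  (cong₂ combine (Inverse.strictlyInverseʳ 2↔Bool s) (index-vector {r} j))
  (combine-remQuot {2} (2 ^ r) i)

vector-index : (a : F^ r) → vector r (index a) ≡ a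
vector-index []              = refl
vector-index {suc r} (s ∷ a) = cong₂ _∷_
  (trans (cong (Inverse.to 2↔Bool ∘ proj₁) split) (Inverse.strictlyInverseˡ 2↔Bool s))
  (trans (cong (vector r ∘ proj₂) split) (vector-index a))
  where
  split : remQuot {2} (2 ^ r) (index (s ∷ a)) ≡ (Inverse.from 2↔Bool s , index a)
  split = remQuot-combine {2} (Inverse.from 2↔Bool s) (index a)

coordinates : F^ r ↔ Fin (2 ^ r)
coordinates {r} = mk↔ₛ′ index (vector r) (index-vector {r}) vector-index

e : F^ r → F^ (2 ^ r)
e a = unit (index a)

coordinatePermutation : (F^ r ↔ F^ r) → Permutation′ (2 ^ r)
coordinatePermutation ρ = coordinates ↔-∘ (ρ ↔-∘ ↔-sym coordinates)

-- The columns of the matrix are all the vectors of F^ r, so its product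
-- with c is the sum of the a with c_a = 1.
ℋ : ∀ r → Code (2 ^ r)
ℋ r c = tabulate (vector r) · c ≡ 𝟎 × 2 ∣ wt c

ℋₐ : F^ r → Code (2 ^ r)
ℋₐ {r} a z = ∃[ h ] ℋ r h × h ⊕ e a ⊕ e (𝟎 {r}) ≡ z

Sℋ : (F^ r ↔ F^ r) → Code (2 ^ r + 2 ^ r)
Sℋ ρ z = ∃[ a ] (ℋₐ a ×ᶜ ℋₐ (Inverse.to ρ a)) z

private
  split-++ : (x : F^ m) (y : F^ n) → take m (x ++ y) ≡ x × drop m (x ++ y) ≡ y
  split-++ {m} x y = ++-injective (take m (x ++ y)) x (take++drop≡id m (x ++ y))

infixr 5 _∥_
_∥_ : (F^ m ↔ F^ m) → (F^ n ↔ F^ n) → (F^ (m + n) ↔ F^ (m + n))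
_∥_ {m} {n} τ σ = mk↔ₛ′
  (both (Inverse.to τ) (Inverse.to σ))
  (both (Inverse.from τ) (Inverse.from σ))
  (inverse (Inverse.to τ) (Inverse.from τ) (Inverse.to σ) (Inverse.from σ)
    (Inverse.strictlyInverseˡ τ) (Inverse.strictlyInverseˡ σ))
  (inverse (Inverse.from τ) (Inverse.to τ) (Inverse.from σ) (Inverse.to σ)
    (Inverse.strictlyInverseʳ τ) (Inverse.strictlyInverseʳ σ))
  where
  both : (F^ m → F^ m) → (F^ n → F^ n) → F^ (m + n) → F^ (m + n)
  both f g z = f (take m z) ++ g (drop m z)

  inverse : (f f′ : F^ m → F^ m) (g g′ : F^ n → F^ n) →
            (∀ x → f (f′ x) ≡ x) → (∀ y → g (g′ y) ≡ y) → ∀ z → both f g (both f′ g′ z) ≡ z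
  inverse f f′ g g′ p q z = trans
    (cong₂ _++_
      (trans (cong f (proj₁ (split-++ (f′ (take m z)) (g′ (drop m z))))) (p (take m z)))
      (trans (cong g (proj₂ (split-++ (f′ (take m z)) (g′ (drop m z))))) (q (drop m z))))
    (take++drop≡id m z)

ρ[ℋ] : (F^ r ↔ F^ r) → Code (2 ^ r)
ρ[ℋ] {r} ρ x = ∃[ c ] ℋ r c × permute (coordinatePermutation ρ) c ≡ x

IsDistension : (F^ r ↔ F^ r) → ℤ → Set
IsDistension {r} ρ l =
  ∃[ d ] HasDimension (ℋ r ∩ ρ[ℋ] ρ) d × l ≡ + (2 ^ r) ℤ.- + r ℤ.- + 1 ℤ.- + d

triple : F^ r → F^ r → F^ r → Subset (2 ^ r)
triple a b c = ⁅ index a ⁆ ∪ ⁅ index b ⁆ ∪ ⁅ index c ⁆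

Star : F^ r → Pred (Subset (2 ^ r)) 0ℓ
Star a t = ∃[ b ] b ≢ 𝟎 × b ≢ a × triple a b (a ⊕ b) ≡ t

ρ[Star] : (F^ r ↔ F^ r) → F^ r → Pred (Subset (2 ^ r)) 0ℓ
ρ[Star] ρ a t = ∃[ b ] b ≢ 𝟎 × b ≢ a × triple (f a) (f b) (f (a ⊕ b)) ≡ t
  where f = Inverse.to ρ

PreservesStar : (F^ r ↔ F^ r) → Pred (F^ r) 0ℓ
PreservesStar ρ a = a ≢ 𝟎 × ρ[Star] ρ a ≐ Star (Inverse.to ρ a)

-- When ρ fixes 𝟎, the number n of such a is one less than a power of two,
-- so the logarithm is exact.
IsDeficiency : (F^ r ↔ F^ r) → ℤ → Set
IsDeficiency {r} ρ k =
  ∃[ n ] HasSize (SubsetSetoid (PreservesStar ρ)) n × k ≡ + r ℤ.- + ⌊log₂ (n + 1) ⌋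

{-# OPTIONS --safe #-}

-- Let s be the syndrome map and write z = x | y. Then z lies in S_{ℋ,ρ} exactly
-- when x and y are even and s(y) = ρ(s(x)), so S_{ℋ,ρ} is the preimage of the graph
-- of ρ under the surjective linear map z ↦ (parities of x and y, s(x), s(y)).
--
-- For ρ(𝟎) = 𝟎, the span of S_{ℋ,ρ} is the preimage of the span of the graph, and
-- the kernel is the preimage of {a | ρ(a) : a ∈ A}, where A consists of the a with
-- ρ(a + b) = ρ(a) + ρ(b) for all b. Both are direct sums when ρ = τ|σ. Sending x to
-- the sum of the vectors ρ⁻¹(b) | b with x_b = 1 maps F^(2^r) onto the span of the
-- graph, and ℋ ∩ ρ(ℋ) is the even half of the kernel; this gives the rank. A nonzero
-- a preserves its star exactly when a ∈ A, so the deficiency is the codimension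
-- of A; this gives the dimension of the kernel.
--
-- If g_a = (a, M_a), the automorphism property reads ρ(a + M_a b) = ρ(a) + M_ρ(a) ρ(b).
-- Hence the maps u | v ↦ (x + M_a u) | (y + M_ρ(a) v) with a = s(x), where the matrices
-- permute the coordinates, form a group acting regularly on the codewords x | y.
module Submission where

open import Defs
open import Algebra.Bundles using (Group)
open import Algebra.Morphism.Structures using (module GroupMorphisms)
import Algebra.Properties.Group as GroupProperties
open import Data.Bool using (Bool; true; false; _xor_)
import Data.Bool.Properties as Bool
open import Data.Fin as Fin using (Fin; zero; suc; toℕ; _↑ˡ_; _↑ʳ_; punchOut)
open import Data.Fin.Permutation as Perm using (Permutation′; _⟨$⟩ʳ_; _⟨$⟩ˡ_; _∘ₚ_; inverseˡ; inverseʳ)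
open import Data.Fin.Properties using (injective⇒≤; any?; punchOut-injective; toℕ-↑ˡ; splitAt-↑ˡ; splitAt-↑ʳ; +↔⊎; join-splitAt)
open import Data.Fin.Subset as Subset using (_∪_; ⁅_⁆)
open import Data.Fin.Subset.Properties using (x∈⁅x⁆; x∈⁅y⁆⇒x≡y; x∈p∪q⁻; x∈p∪q⁺)
open import Data.Integer as ℤ using (ℤ; +_)
import Data.Integer.Tactic.RingSolver as ℤ
open import Data.Nat as ℕ using (ℕ; zero; suc; _+_; _^_; _≤_; z≤n; s≤s)
open import Data.Nat.Divisibility using (_∣_; divides; ∣m+n∣m⇒∣n; ∣1⇒≡1; ∣m∣n⇒∣m+n; ∣-refl)
open import Data.Nat.Logarithm using (⌊log₂_⌋; ⌊log₂[2^n]⌋≡n)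
import Data.Nat.Properties as ℕ
open import Data.Product using (∃; ∃-syntax; ∃!; _×_; _,_; proj₁; proj₂)
open import Data.Sum using (_⊎_; inj₁; inj₂)
open import Data.Sum.Function.Propositional using (_⊎-↔_)
open import Data.Vec using (Vec; []; _∷_; _++_; map; tabulate; lookup; take; drop; splitAt; cast)
open import Data.Vec.Properties using (≡-dec; zipWith-++; take-zipWith; drop-zipWith; tabulate-∘; tabulate-cong; tabulate∘lookup; lookup∘tabulate; lookup∘update; lookup∘update′; lookup-replicate; map-id; ∷-injective; ∷-injectiveˡ; ∷-injectiveʳ; ++-injective; take++drop≡id; cast-is-id)
open import Data.Vec.Relation.Unary.All as All using (All; []; _∷_)
import Data.Vec.Relation.Unary.All.Properties as All
open import Function using (_∘_; _↔_; Inverse; _⇔_; mk⇔; mk↔ₛ′; Equivalence; Injective)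
open import Function.Construct.Composition using (_↔-∘_) renaming (inverse to Inverse-∘)
open import Function.Construct.Symmetry using (↔-sym)
open import Level using (0ℓ)
open import Relation.Binary using (DecidableEquality; Setoid)
open import Relation.Binary.PropositionalEquality using (_≡_; _≢_; refl; sym; trans; cong; cong₂; subst; module ≡-Reasoning)
open import Relation.Nullary using (Dec; yes; no; contradiction)
open import Relation.Nullary.Decidable using (map′; ¬?; decidable-stable; _⊎-dec_; _×-dec_)
open import Relation.Unary using (Pred; Decidable; U; _∩_; _≐_; _⊆_)

-- Both dimension formulas are one count. The syndrome map is onto a space of dimension 2 + 2(r₁ +
-- r₂), so its kernel has dimension κ = 2^(r₁+r₂+1) - 2 - 2(r₁ + r₂), and taking preimages adds κ.
-- The span of the graph of τ has dimension 2^r₁ - 1 - dim(ℋ ∩ τ(ℋ)) = r₁ + l₁, and the set A for τ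
-- has dimension r₁ - k₁; likewise for σ. Extended perfectness comes from the bijectivity of ρ. Let
-- a and b be the syndromes of the halves of an even vector. If both halves are even, replacing a by
-- ρ⁻¹(b) gives a codeword; if both are odd, replacing b by ρ(a) does. Once one flipped coordinate
-- is prescribed, exactly one second flip achieves this. A dimension here is an explicit basis, so
-- dimensions are produced by finite search and then compared through their uniqueness.

private
  variable
    d k l m n r r₁ r₂ : ℕ

-- Arithmetic of vectors

infix 4 _≟_
_≟_ : DecidableEquality (F^ n)
_≟_ = ≡-dec Bool._≟_

⊕-cancelˡ : (x y : F^ n) → x ⊕ (x ⊕ y) ≡ y
⊕-cancelˡ x y = trans (sym (⊕-assoc x x y)) (trans (cong (_⊕ y) (⊕-same x)) (⊕-identityˡ y))

⊕-cancelʳ : (x y : F^ n) → (x ⊕ y) ⊕ y ≡ x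
⊕-cancelʳ x y = trans (⊕-assoc x y y) (trans (cong (x ⊕_) (⊕-same y)) (⊕-identityʳ x))

⊕-transpose : {x y z : F^ n} → x ⊕ y ≡ z → y ≡ x ⊕ z
⊕-transpose {x = x} {y} eq = trans (sym (⊕-cancelˡ x y)) (cong (x ⊕_) eq)

⊕≡𝟎⇒≡ : {x y : F^ n} → x ⊕ y ≡ 𝟎 → x ≡ y
⊕≡𝟎⇒≡ {x = x} eq = trans (sym (⊕-identityʳ x)) (sym (⊕-transpose eq))

++-⊕ : (x x′ : F^ m) (y y′ : F^ n) → (x ⊕ x′) ++ (y ⊕ y′) ≡ (x ++ y) ⊕ (x′ ++ y′)
++-⊕ x x′ y y′ = sym (zipWith-++ _xor_ x y x′ y′)

𝟎++𝟎 : 𝟎 {m} ++ 𝟎 {n} ≡ 𝟎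
𝟎++𝟎 {zero}  = refl
𝟎++𝟎 {suc m} = cong (false ∷_) (𝟎++𝟎 {m})

take-++ : (x : F^ m) (y : F^ n) → take m (x ++ y) ≡ x
take-++ {m} x y = proj₁ (++-injective (take m (x ++ y)) x (take++drop≡id m (x ++ y)))

drop-++ : (x : F^ m) (y : F^ n) → drop m (x ++ y) ≡ y
drop-++ {m} x y = proj₂ (++-injective (take m (x ++ y)) x (take++drop≡id m (x ++ y)))

-- Additive maps and subspaces

Additive : (F^ m → F^ n) → Set
Additive f = ∀ x y → f (x ⊕ y) ≡ f x ⊕ f y

take-⊕ : ∀ m {n} → Additive (take m {n})
take-⊕ m = take-zipWith _xor_

drop-⊕ : ∀ m {n} → Additive (drop m {n})
drop-⊕ m = drop-zipWith _xor_

module _ {f : F^ m → F^ n} (f-⊕ : Additive f) where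
  open ≡-Reasoning

  additive-𝟎 : f 𝟎 ≡ 𝟎
  additive-𝟎 = begin
    f 𝟎          ≡⟨ cong f (⊕-same 𝟎) ⟨
    f (𝟎 ⊕ 𝟎)    ≡⟨ f-⊕ 𝟎 𝟎 ⟩
    f 𝟎 ⊕ f 𝟎    ≡⟨ ⊕-same (f 𝟎) ⟩
    𝟎            ∎

  additive-⋆ : ∀ s x → f (s ⋆ x) ≡ s ⋆ f x
  additive-⋆ false x = trans (cong f (⋆-zeroˡ x)) (trans additive-𝟎 (sym (⋆-zeroˡ (f x))))
  additive-⋆ true  x = trans (cong f (map-id x)) (sym (map-id (f x)))

  additive-· : (vs : Vec (F^ m) k) (x : F^ k) → f (vs · x) ≡ map f vs · x
  additive-· []       []      = additive-𝟎
  additive-· (v ∷ vs) (s ∷ x) =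
    trans (f-⊕ (s ⋆ v) (vs · x)) (cong₂ _⊕_ (additive-⋆ s v) (additive-· vs x))

  additive-I : ∀ x → f x ≡ tabulate (f ∘ unit) · x
  additive-I x = begin
    f x                        ≡⟨ cong f (I-· x) ⟨
    f (I · x)                  ≡⟨ additive-· I x ⟩
    map f I · x                ≡⟨ cong (_· x) (tabulate-∘ f unit) ⟨
    tabulate (f ∘ unit) · x    ∎

-- Permutations, parities and syndromes are all additive, so identities between them are checked on
-- unit vectors.
additive-ext : {f g : F^ m → F^ n} → Additive f → Additive g →
               (∀ i → f (unit i) ≡ g (unit i)) → ∀ x → f x ≡ g x
additive-ext f-⊕ g-⊕ eq x =
  trans (additive-I f-⊕ x) (trans (cong (_· x) (tabulate-cong eq)) (sym (additive-I g-⊕ x)))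

++-additive : {f : F^ m → F^ n} {g : F^ m → F^ k} → Additive f → Additive g → Additive (λ x → f x ++ g x)
++-additive {f = f} {g} f-⊕ g-⊕ x y = trans (cong₂ _++_ (f-⊕ x y) (g-⊕ x y)) (++-⊕ (f x) (f y) (g x) (g y))

++𝟎-⊕ : ∀ m n → Additive {m} {m + n} (_++ 𝟎)
++𝟎-⊕ m n x y = trans (cong ((x ⊕ y) ++_) (sym (⊕-same 𝟎))) (++-⊕ x y 𝟎 𝟎)

𝟎++-⊕ : ∀ m n → Additive {n} {m + n} (𝟎 ++_)
𝟎++-⊕ m n x y = trans (cong (_++ (x ⊕ y)) (sym (⊕-same 𝟎))) (++-⊕ 𝟎 𝟎 x y)

∘-additive : {f : F^ m → F^ n} {g : F^ k → F^ m} → Additive f → Additive g → Additive (f ∘ g)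
∘-additive {f = f} f-⊕ g-⊕ x y = trans (cong f (g-⊕ x y)) (f-⊕ _ _)

-- Over GF(2) the only scalars are 0 and 1, so closure under scalars is derived.
record IsSubspace (V : Pred (F^ n) 0ℓ) : Set where
  field
    𝟎-closed : V 𝟎
    ⊕-closed : ∀ {x y} → V x → V y → V (x ⊕ y)

  ⋆-closed : ∀ s {x} → V x → V (s ⋆ x)
  ⋆-closed false {x} x∈ = subst V (sym (⋆-zeroˡ x)) 𝟎-closed
  ⋆-closed true  {x} x∈ = subst V (sym (map-id x)) x∈

  ·-closed : {vs : Vec (F^ n) k} → All V vs → ∀ x → V (vs · x)
  ·-closed []         []      = 𝟎-closed
  ·-closed (v∈ ∷ vs∈) (s ∷ x) = ⊕-closed (⋆-closed s v∈) (·-closed vs∈ x)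

open IsSubspace

Kernel : (F^ m → F^ n) → Pred (F^ m) 0ℓ
Kernel f x = f x ≡ 𝟎

Image : (F^ m → F^ n) → Pred (F^ m) 0ℓ → Pred (F^ n) 0ℓ
Image f V y = ∃[ x ] V x × f x ≡ y

preimage-subspace : {f : F^ m → F^ n} {V : Pred (F^ n) 0ℓ} → Additive f → IsSubspace V → IsSubspace (V ∘ f)
preimage-subspace {V = V} f-⊕ V-sub = record
  { 𝟎-closed = subst V (sym (additive-𝟎 f-⊕)) (𝟎-closed V-sub)
  ; ⊕-closed = λ x∈ y∈ → subst V (sym (f-⊕ _ _)) (⊕-closed V-sub x∈ y∈)
  }

image-subspace : {f : F^ m → F^ n} {V : Pred (F^ m) 0ℓ} → Additive f → IsSubspace V → IsSubspace (Image f V)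
image-subspace f-⊕ V-sub = record
  { 𝟎-closed = 𝟎 , 𝟎-closed V-sub , additive-𝟎 f-⊕
  ; ⊕-closed = λ (x , x∈ , p) (y , y∈ , q) →
      x ⊕ y , ⊕-closed V-sub x∈ y∈ , trans (f-⊕ x y) (cong₂ _⊕_ p q)
  }

zero-subspace : IsSubspace {n} (_≡ 𝟎)
zero-subspace = record { 𝟎-closed = refl ; ⊕-closed = λ p q → trans (cong₂ _⊕_ p q) (⊕-same 𝟎) }

full-subspace : IsSubspace {n} U
full-subspace = record { 𝟎-closed = _ ; ⊕-closed = _ }

∩-subspace : {V W : Pred (F^ n) 0ℓ} → IsSubspace V → IsSubspace W → IsSubspace (V ∩ W)
∩-subspace V-sub W-sub = record
  { 𝟎-closed = 𝟎-closed V-sub , 𝟎-closed W-sub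
  ; ⊕-closed = λ (x∈ , x∈′) (y∈ , y∈′) → ⊕-closed V-sub x∈ y∈ , ⊕-closed W-sub x∈′ y∈′
  }

·-++ : (us : Vec (F^ n) k) (vs : Vec (F^ n) l) (x : F^ k) (y : F^ l) → (us ++ vs) · (x ++ y) ≡ us · x ⊕ vs · y
·-++ []       vs []      y = sym (⊕-identityˡ _)
·-++ (u ∷ us) vs (s ∷ x) y = trans (cong (s ⋆ u ⊕_) (·-++ us vs x y)) (sym (⊕-assoc _ _ _))

module _ {C : Pred (F^ n) 0ℓ} where
  ⊆-Span : C ⊆ Span C
  ⊆-Span {x} x∈ = 1 , x ∷ [] , x∈ ∷ [] , true ∷ [] , trans (⊕-identityʳ _) (map-id x)

  Span-subspace : IsSubspace (Span C)
  Span-subspace = record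
    { 𝟎-closed = 0 , [] , [] , [] , refl
    ; ⊕-closed = λ (k , us , us∈ , x , p) (l , vs , vs∈ , y , q) →
        k + l , us ++ vs , All.++⁺ us∈ vs∈ , x ++ y , trans (·-++ us vs x y) (cong₂ _⊕_ p q)
    }

  Span-minimal : {V : Pred (F^ n) 0ℓ} → IsSubspace V → C ⊆ V → Span C ⊆ V
  Span-minimal {V} V-sub C⊆V (k , vs , vs∈ , x , eq) = subst V eq (·-closed V-sub (All.map C⊆V vs∈) x)

-- Dimension

dimension⇒subspace : {V : Pred (F^ n) 0ℓ} → HasDimension V d → IsSubspace V
dimension⇒subspace (vs , _ , V⊆ , ⊆V) = record
  { 𝟎-closed = ⊆V (𝟎 , ·-zero vs)
  ; ⊕-closed = λ x∈ y∈ → let x , p = V⊆ x∈ ; y , q = V⊆ y∈ in ⊆V (x ⊕ y , trans (·-⊕ vs x y) (cong₂ _⊕_ p q))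
  }

HasDimension-resp : {V W : Pred (F^ n) 0ℓ} → V ≐ W → HasDimension V d → HasDimension W d
HasDimension-resp (V⊆W , W⊆V) (vs , ind , V⊆ , ⊆V) = vs , ind , V⊆ ∘ W⊆V , V⊆W ∘ ⊆V

full-dimension : HasDimension {n} U n
full-dimension = I , (λ x eq → trans (sym (I-· x)) eq) , (λ {v} _ → v , I-· v) , _

zero-dimension : HasDimension {n} (_≡ 𝟎) 0
zero-dimension = [] , (λ { [] _ → refl }) , (λ eq → [] , sym eq) , λ { ([] , eq) → sym eq }

-- Rank-nullity: a basis of the kernel is completed by lifts of a basis of the image.
dimension-extension : {f : F^ m → F^ n} {V : Pred (F^ m) 0ℓ} → Additive f → IsSubspace V →
                      HasDimension (V ∩ Kernel f) k → HasDimension (Image f V) l → HasDimension V (k + l)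
dimension-extension {m = m} {n = n} {k = k} {l = l} {f = f} {V} f-⊕ V-sub (us , us-ind , K⊆ , ⊆K) (ws , ws-ind , W⊆ , ⊆W) =
  us ++ vs , independent , ⊆-span , span-⊆
  where
  open ≡-Reasoning

  lift : ∀ i → Image f V (lookup ws i)
  lift i = ⊆W (unit i , ·-unit ws i)

  vs : Vec (F^ m) l
  vs = tabulate (proj₁ ∘ lift)

  f-vs : ∀ y → f (vs · y) ≡ ws · y
  f-vs y = begin
    f (vs · y)                           ≡⟨ additive-· f-⊕ vs y ⟩
    map f vs · y                         ≡⟨ cong (_· y) (tabulate-∘ f (proj₁ ∘ lift)) ⟨
    tabulate (f ∘ proj₁ ∘ lift) · y      ≡⟨ cong (_· y) (tabulate-cong (proj₂ ∘ proj₂ ∘ lift)) ⟩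
    tabulate (lookup ws) · y             ≡⟨ cong (_· y) (tabulate∘lookup ws) ⟩
    ws · y                               ∎

  vs∈ : ∀ y → V (vs · y)
  vs∈ y = ·-closed V-sub (All.tabulate⁺ (proj₁ ∘ proj₂ ∘ lift)) y

  us∈ : ∀ x → V (us · x) × f (us · x) ≡ 𝟎
  us∈ x = ⊆K (x , refl)

  f-++ : ∀ x y → f ((us ++ vs) · (x ++ y)) ≡ ws · y
  f-++ x y = begin
    f ((us ++ vs) · (x ++ y))    ≡⟨ cong f (·-++ us vs x y) ⟩
    f (us · x ⊕ vs · y)          ≡⟨ f-⊕ _ _ ⟩
    f (us · x) ⊕ f (vs · y)      ≡⟨ cong₂ _⊕_ (proj₂ (us∈ x)) (f-vs y) ⟩
    𝟎 ⊕ ws · y                   ≡⟨ ⊕-identityˡ _ ⟩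
    ws · y                       ∎

  independent : LinearlyIndependent (us ++ vs)
  independent z eq with splitAt k z
  -- `f` kills the `us` part and sends the lifts to `ws`, so a vanishing combination first forces
  -- `y ≡ 𝟎`, and then `x ≡ 𝟎`.
  ... | x , y , refl with refl ← ws-ind y (trans (sym (f-++ x y)) (trans (cong f eq) (additive-𝟎 f-⊕)))
    = trans (cong (_++ 𝟎) (us-ind x (begin
        us · x                     ≡⟨ ⊕-identityʳ _ ⟨
        us · x ⊕ 𝟎                 ≡⟨ cong (us · x ⊕_) (·-zero vs) ⟨
        us · x ⊕ vs · 𝟎            ≡⟨ ·-++ us vs x 𝟎 ⟨
        (us ++ vs) · (x ++ 𝟎)      ≡⟨ eq ⟩
        𝟎                          ∎)))
      (𝟎++𝟎 {k})

  ⊆-span : ∀ {v} → V v → ∃[ x ] (us ++ vs) · x ≡ v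
  ⊆-span {v} v∈ =
    -- Removing a lift of `f v` from `v` leaves an element of the kernel, where `us` is a basis.
    let y , y-eq = W⊆ (v , v∈ , refl)
        x , x-eq = K⊆ (⊕-closed V-sub v∈ (vs∈ y) , (begin
          f (v ⊕ vs · y)        ≡⟨ f-⊕ v (vs · y) ⟩
          f v ⊕ f (vs · y)      ≡⟨ cong (f v ⊕_) (trans (f-vs y) y-eq) ⟩
          f v ⊕ f v             ≡⟨ ⊕-same (f v) ⟩
          𝟎                     ∎))
    in x ++ y , trans (·-++ us vs x y) (trans (cong (_⊕ vs · y) x-eq) (⊕-cancelʳ v (vs · y)))

  span-⊆ : ∀ {v} → ∃[ x ] (us ++ vs) · x ≡ v → V v
  span-⊆ (z , refl) with splitAt k z
  ... | x , y , refl = subst V (sym (·-++ us vs x y)) (⊕-closed V-sub (proj₁ (us∈ x)) (vs∈ y))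

module _ {f : F^ m → F^ n} (f-⊕ : Additive f) where

  dimension-image : {V : Pred (F^ m) 0ℓ} → (∀ {x} → f x ≡ 𝟎 → x ≡ 𝟎) →
                    HasDimension V d → HasDimension (Image f V) d
  dimension-image f-inj (vs , ind , V⊆ , ⊆V) =
    map f vs ,
    (λ x eq → ind x (f-inj (trans (additive-· f-⊕ vs x) eq))) ,
    (λ (v , v∈ , eq) → let x , x-eq = V⊆ v∈ in x , trans (sym (additive-· f-⊕ vs x)) (trans (cong f x-eq) eq)) ,
    λ (x , eq) → vs · x , ⊆V (x , refl) , trans (additive-· f-⊕ vs x) eq

  -- The kernel of `f` lies inside the preimage because `V` contains `𝟎`, and surjectivity makes `V`
  -- the image of its preimage.
  dimension-preimage : {V : Pred (F^ n) 0ℓ} → (∀ y → ∃[ x ] f x ≡ y) →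
                       HasDimension (Kernel f) k → HasDimension V l → HasDimension (V ∘ f) (k + l)
  dimension-preimage {V = V} f-surj ker-dim V-dim = dimension-extension f-⊕ (preimage-subspace f-⊕ V-sub)
    (HasDimension-resp ((λ eq → subst V (sym eq) (𝟎-closed V-sub) , eq) , proj₂) ker-dim)
    (HasDimension-resp
      ((λ {y} y∈ → let x , eq = f-surj y in x , subst V (sym eq) y∈ , eq) , λ (x , x∈ , eq) → subst V eq x∈)
      V-dim)
    where V-sub = dimension⇒subspace V-dim

∃? : {P : Pred (F^ n) 0ℓ} → Decidable P → Dec (∃ P)
∃? {zero}  P? = map′ ([] ,_) (λ { ([] , p) → p }) (P? [])
∃? {suc n} P? = map′
  (λ { (inj₁ (x , p)) → false ∷ x , p ; (inj₂ (x , p)) → true ∷ x , p })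
  (λ { (false ∷ x , p) → inj₁ (x , p) ; (true ∷ x , p) → inj₂ (x , p) })
  (∃? (P? ∘ (false ∷_)) ⊎-dec ∃? (P? ∘ (true ∷_)))

-- By induction on the coordinates: the vectors of `V` beginning with `false` form a subspace of
-- `F^ n`, and the first coordinate either vanishes on `V` or maps it onto `F^ 1`. A search for a
-- vector beginning with `true` decides which.
dimension-exists : {V : Pred (F^ n) 0ℓ} → Decidable V → IsSubspace V → ∃[ d ] HasDimension V d
dimension-exists {zero}  {V} V? V-sub =
  0 , HasDimension-resp ((λ { refl → 𝟎-closed V-sub }) , λ { {[]} _ → refl }) zero-dimension
dimension-exists {suc n} {V} V? V-sub
  with d , V₀-dim ← dimension-exists (V? ∘ (false ∷_)) (preimage-subspace (λ _ _ → refl) V-sub)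
  with ι-dim ← dimension-image {f = false ∷_} (λ _ _ → refl) ∷-injectiveʳ V₀-dim
  with ∃? (V? ∘ (true ∷_))
... | no ∄ = d , HasDimension-resp
  ((λ { (x , x∈ , refl) → x∈ }) ,
   λ { {false ∷ x} x∈ → x , x∈ , refl ; {true ∷ x} x∈ → contradiction (x , x∈) ∄ })
  ι-dim
... | yes (u , u∈) = d + 1 , dimension-extension (take-⊕ 1) V-sub
  (HasDimension-resp
    ((λ { (x , x∈ , refl) → x∈ , refl }) , λ { {false ∷ x} (x∈ , _) → x , x∈ , refl ; {true ∷ x} (_ , ()) })
    ι-dim)
  (HasDimension-resp
    ((λ { {false ∷ []} _ → 𝟎 , 𝟎-closed V-sub , refl ; {true ∷ []} _ → true ∷ u , u∈ , refl }) , _)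
    full-dimension)

-- Encoding vectors by `index` reduces this to comparing 2 ^ m with 2 ^ n.
F^-injective⇒≤ : {f : F^ m → F^ n} → (∀ {x y} → f x ≡ f y → x ≡ y) → m ≤ n
F^-injective⇒≤ {m} {n} {f} f-inj = ℕ.≮⇒≥ λ n<m → ℕ.<⇒≱ (ℕ.^-monoʳ-< 2 (ℕ.s≤s (ℕ.s≤s ℕ.z≤n)) n<m)
  (injective⇒≤ {f = index ∘ f ∘ vector m} λ {i} {j} eq →
    trans (sym (index-vector {m} i))
      (trans (cong index (f-inj (trans (sym (vector-index _)) (trans (cong (vector n) eq) (vector-index _)))))
        (index-vector {m} j)))

-- Rewriting the combinations of one basis in terms of the other is an injection from `F^ k` to
-- `F^ l`, so counting replaces an exchange argument.
dimension-unique : {V : Pred (F^ n) 0ℓ} → HasDimension V k → HasDimension V l → k ≡ l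
dimension-unique V-dim V-dim′ = ℕ.≤-antisym (≤-dim V-dim V-dim′) (≤-dim V-dim′ V-dim)
  where
  ≤-dim : {V : Pred (F^ n) 0ℓ} → HasDimension V k → HasDimension V l → k ≤ l
  ≤-dim (us , us-ind , _ , ⊆V) (vs , _ , V⊆ , _) = F^-injective⇒≤ {f = λ x → proj₁ (V⊆ (⊆V (x , refl)))} λ {x} {y} eq →
    ⊕≡𝟎⇒≡ (us-ind (x ⊕ y) (trans (·-⊕ us x y)
      (trans (cong (_⊕ us · y) (trans (sym (proj₂ (V⊆ (⊆V (x , refl)))))
        (trans (cong (vs ·_) eq) (proj₂ (V⊆ (⊆V (y , refl))))))) (⊕-same _))))

Kernel-dimension : {f : F^ m → F^ n} → Additive f → ∃[ d ] HasDimension (Kernel f) d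
Kernel-dimension {f = f} f-⊕ = dimension-exists (λ x → f x ≟ 𝟎) (preimage-subspace f-⊕ zero-subspace)

Image-dimension : {f : F^ m → F^ n} → Additive f → ∃[ d ] HasDimension (Image f U) d
Image-dimension {f = f} f-⊕ = dimension-exists
  (λ y → map′ (λ (x , eq) → x , _ , eq) (λ (x , _ , eq) → x , eq) (∃? λ x → f x ≟ y))
  (image-subspace f-⊕ full-subspace)

rank-nullity : {f : F^ m → F^ n} → Additive f → HasDimension (Kernel f) k → HasDimension (Image f U) l → k + l ≡ m
rank-nullity f-⊕ ker-dim im-dim = dimension-unique
  (dimension-extension f-⊕ full-subspace (HasDimension-resp ((_ ,_) , proj₂) ker-dim) im-dim)
  full-dimension

lookup-ext : {x y : F^ n} → (∀ i → lookup x i ≡ lookup y i) → x ≡ y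
lookup-ext {x = x} {y} eq = trans (sym (tabulate∘lookup x)) (trans (tabulate-cong eq) (tabulate∘lookup y))

additive-closed : {f : F^ m → F^ n} {V : Pred (F^ n) 0ℓ} → Additive f → IsSubspace V →
                  (∀ i → V (f (unit i))) → ∀ x → V (f x)
additive-closed {V = V} f-⊕ V-sub f∈ x =
  subst V (sym (additive-I f-⊕ x)) (·-closed V-sub (All.tabulate⁺ f∈) x)

-- Parity

parity-⊕ : (x y : F^ n) → parity (x ⊕ y) ≡ parity x xor parity y
parity-⊕ []      []      = refl
parity-⊕ (s ∷ x) (t ∷ y) = trans (cong ((s xor t) xor_) (parity-⊕ x y)) (interchange s t (parity x) (parity y))
  where
  interchange : ∀ s t u v → (s xor t) xor (u xor v) ≡ (s xor u) xor (t xor v)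
  interchange s t u v = ∷-injectiveˡ (⊕-interchange (s ∷ []) (t ∷ []) (u ∷ []) (v ∷ []))

parity-𝟎 : parity (𝟎 {n}) ≡ false
parity-𝟎 {zero}  = refl
parity-𝟎 {suc n} = parity-𝟎 {n}

parity-unit : (i : Fin n) → parity (unit i) ≡ true
parity-unit {suc n} zero    = cong (true xor_) (parity-𝟎 {n})
parity-unit         (suc i) = parity-unit i

-- With values in `F^ 1` instead of `Bool`, parity is subject to the lemmas on additive maps.
parity-additive : Additive {n} (λ x → parity x ∷ [])
parity-additive x y = cong (_∷ []) (parity-⊕ x y)

even⇒2∣wt : (x : F^ n) → parity x ≡ false → 2 ∣ wt x
odd⇒2∣1+wt : (x : F^ n) → parity x ≡ true → 2 ∣ suc (wt x)

even⇒2∣wt []          _  = divides 0 refl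
even⇒2∣wt (false ∷ x) eq = even⇒2∣wt x eq
even⇒2∣wt (true ∷ x)  eq = odd⇒2∣1+wt x (Bool.not-injective eq)

odd⇒2∣1+wt (false ∷ x) eq = odd⇒2∣1+wt x eq
odd⇒2∣1+wt (true ∷ x)  eq = ∣m∣n⇒∣m+n ∣-refl (even⇒2∣wt x (Bool.not-injective eq))

2∣wt⇒even : (x : F^ n) → 2 ∣ wt x → parity x ≡ false
2∣wt⇒even x 2∣ with parity x in eq
... | false = refl
-- Odd parity would make 2 divide both `wt x` and `wt x + 1`, hence 1.
... | true  with () ← ∣1⇒≡1 (∣m+n∣m⇒∣n (subst (2 ∣_) (ℕ.+-comm 1 (wt x)) (odd⇒2∣1+wt x eq)) 2∣)

-- Coordinate permutations

lookup-unit-≢ : {i j : Fin n} → i ≢ j → lookup (unit j) i ≡ false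
lookup-unit-≢ {i = i} i≢j = trans (lookup∘update′ i≢j 𝟎 true) (lookup-replicate i false)

permute-unit : (π : Permutation′ n) (i : Fin n) → permute π (unit i) ≡ unit (π ⟨$⟩ʳ i)
permute-unit π i = lookup-ext λ j → trans (lookup∘tabulate _ j) (lookup-unit j)
  where
  lookup-unit : ∀ j → lookup (unit i) (π ⟨$⟩ˡ j) ≡ lookup (unit (π ⟨$⟩ʳ i)) j
  lookup-unit j with j Fin.≟ π ⟨$⟩ʳ i
  ... | yes refl = trans (cong (lookup (unit i)) (inverseˡ π))
                     (trans (lookup∘update i 𝟎 true) (sym (lookup∘update (π ⟨$⟩ʳ i) 𝟎 true)))
  ... | no j≢    = trans (lookup-unit-≢ λ eq → j≢ (trans (sym (inverseʳ π)) (cong (π ⟨$⟩ʳ_) eq)))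
                     (sym (lookup-unit-≢ j≢))

parity-permute : (π : Permutation′ n) (x : F^ n) → parity (permute π x) ≡ parity x
parity-permute π x = ∷-injectiveˡ (additive-ext
  (∘-additive {f = λ x → parity x ∷ []} parity-additive (permute-⊕ π)) parity-additive
  (λ i → cong (_∷ []) (trans (cong parity (permute-unit π i)) (trans (parity-unit (π ⟨$⟩ʳ i)) (sym (parity-unit i)))))
  x)

permute-flip : (π : Permutation′ n) (x : F^ n) → permute π (permute (Perm.flip π) x) ≡ x
permute-flip π x = trans (sym (permute-∘ π (Perm.flip π) x))
  (trans (permute-cong {π = Perm.flip π Perm.∘ₚ π} {Perm.id} (λ _ → inverseʳ π) x) (permute-id x))

permute-e : (ρ : F^ r ↔ F^ r) (a : F^ r) → permute (coordinatePermutation ρ) (e a) ≡ e (Inverse.to ρ a)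
permute-e ρ a = trans (permute-unit (coordinatePermutation ρ) (index a))
  (cong (e ∘ Inverse.to ρ) (vector-index a))

-- Syndromes

module _ (r : ℕ) where

  syndrome : F^ (2 ^ r) → F^ r
  syndrome x = tabulate (vector r) · x

  syndrome-⊕ : Additive syndrome
  syndrome-⊕ = ·-⊕ (tabulate (vector r))

  e-additive-ext : {f g : F^ (2 ^ r) → F^ n} → Additive f → Additive g →
                   (∀ a → f (e {r} a) ≡ g (e a)) → ∀ x → f x ≡ g x
  e-additive-ext {f = f} {g} f-⊕ g-⊕ eq = additive-ext f-⊕ g-⊕
    λ i → subst (λ j → f (unit j) ≡ g (unit j)) (index-vector {r} i) (eq (vector r i))

syndrome-e : (a : F^ r) → syndrome r (e a) ≡ a
syndrome-e {r} a = trans (·-unit (tabulate (vector r)) (index a))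
  (trans (lookup∘tabulate (vector r) (index a)) (vector-index a))

syndrome-permute : (ρ : F^ r ↔ F^ r) → Additive (Inverse.to ρ) → ∀ x →
                   syndrome r (permute (coordinatePermutation ρ) x) ≡ Inverse.to ρ (syndrome r x)
syndrome-permute {r} ρ ρ-⊕ = e-additive-ext r
  (∘-additive (syndrome-⊕ r) (permute-⊕ (coordinatePermutation ρ))) (∘-additive ρ-⊕ (syndrome-⊕ r))
  λ a → trans (cong (syndrome r) (permute-e ρ a))
    (trans (syndrome-e (Inverse.to ρ a)) (cong (Inverse.to ρ) (sym (syndrome-e a))))

-- `e 𝟎` has odd parity and zero syndrome, so adding it corrects the parity without moving the
-- syndrome.
parity,syndrome-surjective : ∀ p (a : F^ r) → ∃[ x ] parity x ≡ p × syndrome r x ≡ a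
parity,syndrome-surjective {r} true  a = e a , parity-unit (index a) , syndrome-e a
parity,syndrome-surjective {r} false a = e a ⊕ e (𝟎 {r}) ,
  trans (parity-⊕ (e a) (e (𝟎 {r}))) (cong₂ _xor_ (parity-unit (index a)) (parity-unit (index (𝟎 {r})))) ,
  trans (syndrome-⊕ r (e a) (e (𝟎 {r})))
    (trans (cong₂ _⊕_ (syndrome-e a) (syndrome-e (𝟎 {r}))) (⊕-identityʳ a))

ℋ⇔ : {x : F^ (2 ^ r)} → ℋ r x ⇔ (parity x ≡ false × syndrome r x ≡ 𝟎)
ℋ⇔ {x = x} = mk⇔ (λ (s , w) → 2∣wt⇒even x w , s) (λ (p , s) → s , even⇒2∣wt x p)

-- Adding `e a` and `e 𝟎` keeps the parity and adds `a` to the syndrome.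
ℋₐ⇔ : {a : F^ r} {x : F^ (2 ^ r)} → ℋₐ a x ⇔ (parity x ≡ false × syndrome r x ≡ a)
ℋₐ⇔ {r} {a} {x} = mk⇔
  (λ (h , h∈ , eq) → let p , s = Equivalence.to (ℋ⇔ {r}) h∈ in
    trans (cong parity (sym eq)) (trans (parity-shift h) p) ,
    trans (cong (syndrome r) (sym eq)) (trans (syndrome-shift h) (trans (cong (_⊕ a) s) (⊕-identityˡ a))))
  -- The shift is an involution, so it also brings `x` back into `ℋ`.
  (λ (p , s) → x ⊕ e a ⊕ e (𝟎 {r}) ,
    Equivalence.from (ℋ⇔ {r})
      (trans (parity-shift x) p , trans (syndrome-shift x) (trans (cong (_⊕ a) s) (⊕-same a))) ,
    trans (cong (_⊕ e (𝟎 {r})) (shuffle x (e a) (e (𝟎 {r})))) (⊕-cancelʳ x (e (𝟎 {r}))))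
  where
  open ≡-Reasoning

  shuffle : (x u v : F^ n) → (x ⊕ u ⊕ v) ⊕ u ≡ x ⊕ v
  shuffle x u v = begin
    (x ⊕ u ⊕ v) ⊕ u      ≡⟨ cong (_⊕ u) (⊕-assoc x u v) ⟩
    (x ⊕ (u ⊕ v)) ⊕ u    ≡⟨ cong (λ t → (x ⊕ t) ⊕ u) (⊕-comm u v) ⟩
    (x ⊕ (v ⊕ u)) ⊕ u    ≡⟨ cong (_⊕ u) (⊕-assoc x v u) ⟨
    (x ⊕ v ⊕ u) ⊕ u      ≡⟨ ⊕-cancelʳ (x ⊕ v) u ⟩
    x ⊕ v                ∎

  parity-shift : ∀ h → parity (h ⊕ e a ⊕ e (𝟎 {r})) ≡ parity h
  parity-shift h = begin
    parity (h ⊕ e a ⊕ e (𝟎 {r}))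
      ≡⟨ trans (parity-⊕ (h ⊕ e a) (e (𝟎 {r}))) (cong (_xor parity (e (𝟎 {r}))) (parity-⊕ h (e a))) ⟩
    (parity h xor parity (e a)) xor parity (e (𝟎 {r}))
      ≡⟨ cong₂ (λ s t → (parity h xor s) xor t) (parity-unit (index a)) (parity-unit (index (𝟎 {r}))) ⟩
    (parity h xor true) xor true
      ≡⟨ ∷-injectiveˡ (⊕-cancelʳ (parity h ∷ []) (true ∷ [])) ⟩
    parity h ∎

  syndrome-shift : ∀ h → syndrome r (h ⊕ e a ⊕ e (𝟎 {r})) ≡ syndrome r h ⊕ a
  syndrome-shift h = begin
    syndrome r (h ⊕ e a ⊕ e (𝟎 {r}))
      ≡⟨ trans (syndrome-⊕ r (h ⊕ e a) (e (𝟎 {r}))) (cong (_⊕ syndrome r (e (𝟎 {r}))) (syndrome-⊕ r h (e a))) ⟩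
    syndrome r h ⊕ syndrome r (e a) ⊕ syndrome r (e (𝟎 {r}))
      ≡⟨ cong₂ (λ s t → syndrome r h ⊕ s ⊕ t) (syndrome-e a) (syndrome-e (𝟎 {r})) ⟩
    syndrome r h ⊕ a ⊕ 𝟎
      ≡⟨ ⊕-identityʳ _ ⟩
    syndrome r h ⊕ a ∎

-- The code as the preimage of a graph

module _ (r : ℕ) where
  private
    N = 2 ^ r

  syndromes : F^ (N + N) → F^ (2 + (r + r))
  syndromes z = parity (take N z) ∷ parity (drop N z) ∷ (syndrome r (take N z) ++ syndrome r (drop N z))

  syndromes-⊕ : Additive syndromes
  syndromes-⊕ z w = cong₂ _∷_ (parity-part (take-⊕ N)) (cong₂ _∷_ (parity-part (drop-⊕ N))
    (++-additive (∘-additive (syndrome-⊕ r) (take-⊕ N)) (∘-additive (syndrome-⊕ r) (drop-⊕ N)) z w))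
    where
    parity-part : {f : F^ (N + N) → F^ N} → Additive f → parity (f (z ⊕ w)) ≡ parity (f z) xor parity (f w)
    parity-part {f} f-⊕ = trans (cong parity (f-⊕ z w)) (parity-⊕ (f z) (f w))

  syndromes-++ : ∀ x y → syndromes (x ++ y) ≡ parity x ∷ parity y ∷ (syndrome r x ++ syndrome r y)
  syndromes-++ x y = cong₂ (λ x y → parity x ∷ parity y ∷ (syndrome r x ++ syndrome r y)) (take-++ x y) (drop-++ x y)

  syndromes-surjective : ∀ w → ∃[ z ] syndromes z ≡ w
  syndromes-surjective (p ∷ q ∷ w)
    with splitAt r w
  ... | a , b , refl
    with x , refl , refl ← parity,syndrome-surjective p a
    with y , refl , refl ← parity,syndrome-surjective q b
    = x ++ y , syndromes-++ x y

-- The two zeros are the even parities of the halves, so `Image pad (Graph ρ)` is the set of values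
-- that `syndromes` takes on codewords.
pad : F^ n → F^ (2 + n)
pad w = false ∷ false ∷ w

pad-injective : {v w : F^ n} → pad v ≡ pad w → v ≡ w
pad-injective eq = ∷-injectiveʳ (∷-injectiveʳ eq)

Graph : (F^ r ↔ F^ r) → Pred (F^ (r + r)) 0ℓ
Graph ρ w = ∃[ a ] a ++ Inverse.to ρ a ≡ w

Graph⁻ : {ρ : F^ r ↔ F^ r} {a b : F^ r} → Graph ρ (a ++ b) → Inverse.to ρ a ≡ b
Graph⁻ {a = a} (c , eq) with refl , eq′ ← ++-injective c a eq = eq′

Sℋ≐ : (ρ : F^ r ↔ F^ r) → Sℋ ρ ≐ Image pad (Graph ρ) ∘ syndromes r
Sℋ≐ {r} ρ = to , from
  where
  N = 2 ^ r

  to : Sℋ ρ ⊆ Image pad (Graph ρ) ∘ syndromes r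
  to (a , x , y , x∈ , y∈ , refl)
    with p , s ← Equivalence.to (ℋₐ⇔ {r} {a}) x∈
       | q , t ← Equivalence.to (ℋₐ⇔ {r} {Inverse.to ρ a}) y∈ =
    a ++ Inverse.to ρ a , (a , refl) , sym (trans (syndromes-++ r x y) (cong₂ _∷_ p (cong₂ _∷_ q (cong₂ _++_ s t))))

  from : Image pad (Graph ρ) ∘ syndromes r ⊆ Sℋ ρ
  from {z} (_ , (a , refl) , eq) =
    let p , eq′ = ∷-injective eq
        q , eq″ = ∷-injective eq′
        s , t   = ++-injective a (syndrome r (take N z)) eq″
    in a , take N z , drop N z ,
       Equivalence.from (ℋₐ⇔ {r}) (sym p , sym s) , Equivalence.from (ℋₐ⇔ {r}) (sym q , sym t) , take++drop≡id N z

-- Rank and kernel of the code for a given `ρ`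

Span-mono : {C D : Pred (F^ n) 0ℓ} → C ⊆ D → Span C ⊆ Span D
Span-mono C⊆D = Span-minimal Span-subspace (⊆-Span ∘ C⊆D)

module _ {f : F^ m → F^ n} (f-⊕ : Additive f) where

  Span-image : {C : Pred (F^ m) 0ℓ} → Span (Image f C) ≐ Image f (Span C)
  Span-image =
    Span-minimal (image-subspace f-⊕ Span-subspace) (λ (x , x∈ , eq) → x , ⊆-Span x∈ , eq) ,
    λ { (x , x∈ , refl) → Span-minimal (preimage-subspace f-⊕ Span-subspace) (λ {y} y∈ → ⊆-Span (y , y∈ , refl)) x∈ }

  -- Since `C` contains `𝟎`, its preimage contains the kernel of `f`. A vector with image in the
  -- span therefore differs from a sum of lifted elements of `C` by an element of the preimage
  -- itself.
  Span-preimage : {C : Pred (F^ n) 0ℓ} → (∀ y → ∃[ x ] f x ≡ y) → C 𝟎 → Span (C ∘ f) ≐ Span C ∘ f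
  Span-preimage {C} f-surj 𝟎∈C = Span-minimal (preimage-subspace f-⊕ Span-subspace) ⊆-Span , ⊇
    where
    ⊇ : Span C ∘ f ⊆ Span (C ∘ f)
    ⊇ {x} fx∈ =
      let x′ , x′∈ , eq = Span-minimal (image-subspace f-⊕ Span-subspace)
            (λ {y} y∈ → let x , eq = f-surj y in x , ⊆-Span (subst C (sym eq) y∈) , eq) fx∈
      in subst (Span (C ∘ f)) (⊕-cancelˡ x′ x) (⊕-closed Span-subspace x′∈ (⊆-Span (subst C
           (sym (trans (f-⊕ x′ x) (trans (cong (_⊕ f x) eq) (⊕-same (f x))))) 𝟎∈C)))

pad-⊕ : Additive (pad {n})
pad-⊕ _ _ = refl

𝟎∈Graph : (ρ : F^ r ↔ F^ r) → Inverse.to ρ 𝟎 ≡ 𝟎 → Graph ρ 𝟎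
𝟎∈Graph {r} ρ ρ-𝟎 = 𝟎 , trans (cong (𝟎 ++_) ρ-𝟎) (𝟎++𝟎 {r})

-- The kernel dimension is recorded through a sum, which avoids truncated subtraction.
syndromes-kernel : ∀ r → ∃[ κ ] HasDimension (Kernel (syndromes r)) κ × κ + (2 + (r + r)) ≡ 2 ^ r + 2 ^ r
syndromes-kernel r = let κ , ker-dim = Kernel-dimension (syndromes-⊕ r) in
  κ , ker-dim , rank-nullity (syndromes-⊕ r) ker-dim
    (HasDimension-resp ((λ {w} _ → let z , eq = syndromes-surjective r w in z , _ , eq) , _) full-dimension)

Sℋ-rank : (ρ : F^ r ↔ F^ r) → Inverse.to ρ 𝟎 ≡ 𝟎 →
          HasDimension (Kernel (syndromes r)) k → HasDimension (Span (Graph ρ)) l → HasRank (Sℋ ρ) (k + l)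
Sℋ-rank {r} ρ ρ-𝟎 ker-dim graph-dim = HasDimension-resp
  (Span-mono (proj₂ (Sℋ≐ ρ)) ∘ proj₂ span ∘ proj₂ (Span-image pad-⊕) ,
   proj₁ (Span-image pad-⊕) ∘ proj₁ span ∘ Span-mono (proj₁ (Sℋ≐ ρ)))
  (dimension-preimage (syndromes-⊕ r) (syndromes-surjective r) ker-dim
    (dimension-image pad-⊕ pad-injective graph-dim))
  where
  span : Span (Image pad (Graph ρ) ∘ syndromes r) ≐ Span (Image pad (Graph ρ)) ∘ syndromes r
  span = Span-preimage (syndromes-⊕ r) (syndromes-surjective r) (𝟎 , 𝟎∈Graph ρ ρ-𝟎 , refl)

-- When `f 𝟎 ≡ 𝟎`, these are the linear structures of `f`: the directions in which its derivative is
-- constant.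
AdditiveAt : (F^ m → F^ n) → Pred (F^ m) 0ℓ
AdditiveAt f a = ∀ b → f (a ⊕ b) ≡ f a ⊕ f b

AdditiveAt? : (f : F^ m → F^ n) → Decidable (AdditiveAt f)
AdditiveAt? f a = map′
  (λ ∄ b → decidable-stable (f (a ⊕ b) ≟ f a ⊕ f b) (λ ≢ → ∄ (b , ≢)))
  (λ eq (b , ≢) → ≢ (eq b))
  (¬? (∃? λ b → ¬? (f (a ⊕ b) ≟ f a ⊕ f b)))

AdditiveAt-subspace : {f : F^ m → F^ n} → f 𝟎 ≡ 𝟎 → IsSubspace (AdditiveAt f)
AdditiveAt-subspace {f = f} f-𝟎 = record
  { 𝟎-closed = λ b → trans (cong f (⊕-identityˡ b)) (trans (sym (⊕-identityˡ (f b))) (cong (_⊕ f b) (sym f-𝟎)))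
  ; ⊕-closed = λ {a} {a′} a∈ a′∈ b → begin
      f ((a ⊕ a′) ⊕ b)        ≡⟨ cong f (⊕-assoc a a′ b) ⟩
      f (a ⊕ (a′ ⊕ b))        ≡⟨ a∈ (a′ ⊕ b) ⟩
      f a ⊕ f (a′ ⊕ b)        ≡⟨ cong (f a ⊕_) (a′∈ b) ⟩
      f a ⊕ (f a′ ⊕ f b)      ≡⟨ ⊕-assoc (f a) (f a′) (f b) ⟨
      (f a ⊕ f a′) ⊕ f b      ≡⟨ cong (_⊕ f b) (a∈ a′) ⟨
      f (a ⊕ a′) ⊕ f b        ∎
  }
  where open ≡-Reasoning

AdditiveGraph : (F^ r ↔ F^ r) → Pred (F^ (r + r)) 0ℓ
AdditiveGraph ρ = Image (λ a → a ++ Inverse.to ρ a) (AdditiveAt (Inverse.to ρ))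

-- The map a ↦ a | ρ(a) need not be additive on the whole space, so the dimension is read off in the
-- other direction: the projection `take r` is additive everywhere and injective on the graph.
AdditiveGraph-dimension : (ρ : F^ r ↔ F^ r) → Inverse.to ρ 𝟎 ≡ 𝟎 →
                          HasDimension (AdditiveAt (Inverse.to ρ)) d → HasDimension (AdditiveGraph ρ) d
AdditiveGraph-dimension {r} ρ ρ-𝟎 A-dim = dimension-extension (take-⊕ r) subspace
  (HasDimension-resp
    ((λ { refl → 𝟎-closed subspace , additive-𝟎 (take-⊕ r) }) ,
     λ { ((a , a∈ , refl) , eq) → trans (cong (λ b → b ++ f b) (trans (sym (take-++ a (f a))) eq))
       (trans (cong (𝟎 ++_) ρ-𝟎) (𝟎++𝟎 {r})) })
    zero-dimension)
  (HasDimension-resp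
    ((λ {a} a∈ → a ++ f a , (a , a∈ , refl) , take-++ a (f a)) ,
     λ { (_ , (a , a∈ , refl) , refl) → subst (AdditiveAt f) (sym (take-++ a (f a))) a∈ })
    A-dim)
  where
  f = Inverse.to ρ

  subspace : IsSubspace (AdditiveGraph ρ)
  subspace = record
    { 𝟎-closed = 𝟎 , 𝟎-closed (AdditiveAt-subspace ρ-𝟎) , proj₂ (𝟎∈Graph ρ ρ-𝟎)
    ; ⊕-closed = λ { (a , a∈ , refl) (b , b∈ , refl) →
        a ⊕ b , ⊕-closed (AdditiveAt-subspace ρ-𝟎) a∈ b∈ ,
        trans (cong ((a ⊕ b) ++_) (a∈ b)) (++-⊕ a b (f a) (f b)) }
    }

-- Translation by `x` is an involution, so one inclusion already gives equality.
Ker⇔ : {C : Code n} {x : F^ n} → Ker C x ⇔ (∀ y → C y → C (x ⊕ y))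
Ker⇔ {C = C} {x} = mk⇔ to λ closed → image⊆C closed , C⊆image closed
  where
  to : Ker C x → ∀ y → C y → C (x ⊕ y)
  to (image⊆ , _) y y∈ = image⊆ (y , y∈ , refl)

  image⊆C : (∀ y → C y → C (x ⊕ y)) → x ⊕ᶜ C ⊆ C
  image⊆C closed (y , y∈ , eq) = subst C eq (closed y y∈)

  C⊆image : (∀ y → C y → C (x ⊕ y)) → C ⊆ x ⊕ᶜ C
  C⊆image closed {y} y∈ = x ⊕ y , closed y y∈ , ⊕-cancelˡ x y

-- As `𝟎` is a codeword, an element of the kernel is itself a codeword, with syndromes a | ρ(a).
-- Adding it to a codeword with syndromes b | ρ(b) gives a codeword exactly when ρ(a + b) = ρ(a) +
-- ρ(b), and every b occurs.
Sℋ-Ker : (ρ : F^ r ↔ F^ r) → Inverse.to ρ 𝟎 ≡ 𝟎 → Ker (Sℋ ρ) ≐ Image pad (AdditiveGraph ρ) ∘ syndromes r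
Sℋ-Ker {r} ρ ρ-𝟎 = to , from
  where
  open ≡-Reasoning
  f = Inverse.to ρ

  syndromes-sum : ∀ {z y a b} → pad (a ++ f a) ≡ syndromes r z → pad (b ++ f b) ≡ syndromes r y →
                  pad ((a ⊕ b) ++ (f a ⊕ f b)) ≡ syndromes r (z ⊕ y)
  syndromes-sum {z} {y} {a} {b} p q =
    trans (cong pad (++-⊕ a b (f a) (f b))) (trans (cong₂ _⊕_ p q) (sym (syndromes-⊕ r z y)))

  to : Ker (Sℋ ρ) ⊆ Image pad (AdditiveGraph ρ) ∘ syndromes r
  to {z} z∈Ker
    with closed ← Equivalence.to (Ker⇔ {C = Sℋ ρ}) z∈Ker
    with _ , (a , refl) , p ← proj₁ (Sℋ≐ ρ) (subst (Sℋ ρ) (⊕-identityʳ z)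
      (closed 𝟎 (proj₂ (Sℋ≐ ρ) (𝟎 , 𝟎∈Graph ρ ρ-𝟎 , sym (additive-𝟎 {f = syndromes r} (syndromes-⊕ r))))))
    = a ++ f a , (a , a∈ , refl) , p
    where
    a∈ : AdditiveAt f a
    a∈ b
      with y , q ← syndromes-surjective r (pad (b ++ f b))
      with _ , w∈ , s ← proj₁ (Sℋ≐ ρ) (closed y (proj₂ (Sℋ≐ ρ) (b ++ f b , (b , refl) , sym q)))
      = Graph⁻ {ρ = ρ} (subst (Graph ρ) (pad-injective (trans s (sym (syndromes-sum {a = a} {b} p (sym q))))) w∈)

  from : Image pad (AdditiveGraph ρ) ∘ syndromes r ⊆ Ker (Sℋ ρ)
  from {z} (_ , (a , a∈ , refl) , p) = Equivalence.from (Ker⇔ {C = Sℋ ρ}) λ y y∈ → closed (proj₁ (Sℋ≐ ρ) y∈)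
    where
    closed : ∀ {y} → Image pad (Graph ρ) (syndromes r y) → Sℋ ρ (z ⊕ y)
    closed (_ , (b , refl) , q) = proj₂ (Sℋ≐ ρ)
      (_ , (a ⊕ b , cong ((a ⊕ b) ++_) (a∈ b)) , syndromes-sum {a = a} {b} p q)

Sℋ-Ker-dimension : (ρ : F^ r ↔ F^ r) → Inverse.to ρ 𝟎 ≡ 𝟎 →
                   HasDimension (Kernel (syndromes r)) k → HasDimension (AdditiveAt (Inverse.to ρ)) l →
                   HasDimension (Ker (Sℋ ρ)) (k + l)
Sℋ-Ker-dimension {r} ρ ρ-𝟎 ker-dim A-dim = HasDimension-resp (proj₂ (Sℋ-Ker ρ ρ-𝟎) , proj₁ (Sℋ-Ker ρ ρ-𝟎))
  (dimension-preimage (syndromes-⊕ r) (syndromes-surjective r) ker-dim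
    (dimension-image pad-⊕ pad-injective (AdditiveGraph-dimension ρ ρ-𝟎 A-dim)))

-- Distension

module _ {r : ℕ} (ρ : F^ r ↔ F^ r) where
  open Inverse ρ using (to; from)

  -- θ x is the sum of the vectors ρ⁻¹(b) | b over the b with x_b = 1.
  θ : F^ (2 ^ r) → F^ (r + r)
  θ x = syndrome r (permute (coordinatePermutation (↔-sym ρ)) x) ++ syndrome r x

  θ-⊕ : Additive θ
  θ-⊕ = ++-additive (∘-additive (syndrome-⊕ r) (permute-⊕ (coordinatePermutation (↔-sym ρ)))) (syndrome-⊕ r)

  θ-e : ∀ b → θ (e b) ≡ from b ++ b
  θ-e b = cong₂ _++_ (trans (cong (syndrome r) (permute-e (↔-sym ρ) b)) (syndrome-e (from b))) (syndrome-e b)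

  θ-image : Image θ U ≐ Span (Graph ρ)
  θ-image =
    (λ { (x , _ , refl) → additive-closed θ-⊕ Span-subspace (λ i → ⊆-Span (from (vector r i) ,
       trans (cong (from (vector r i) ++_) (Inverse.strictlyInverseˡ ρ (vector r i)))
         (trans (sym (θ-e (vector r i))) (cong (θ ∘ unit) (index-vector {r} i))))) x }) ,
    Span-minimal (image-subspace θ-⊕ full-subspace)
      λ { (a , refl) → e (to a) , _ , trans (θ-e (to a)) (cong (_++ to a) (Inverse.strictlyInverseʳ ρ a)) }

  -- The first half of `θ x` is the syndrome of ρ⁻¹(x). For even `x` its vanishing puts ρ⁻¹(x) into
  -- ℋ, and that of the second half puts `x` into ℋ.
  θ-kernel : Kernel θ ∩ Kernel (λ x → parity x ∷ []) ≐ ℋ r ∩ ρ[ℋ] ρ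
  θ-kernel = to′ , from′
    where
    π  = coordinatePermutation ρ
    π⁻ = coordinatePermutation (↔-sym ρ)

    to′ : Kernel θ ∩ Kernel (λ x → parity x ∷ []) ⊆ ℋ r ∩ ρ[ℋ] ρ
    to′ {x} (θx≡𝟎 , px≡𝟎) =
      let p , q = ++-injective (syndrome r (permute π⁻ x)) 𝟎 (trans θx≡𝟎 (sym (𝟎++𝟎 {r})))
          even  = ∷-injectiveˡ px≡𝟎
      in Equivalence.from (ℋ⇔ {r}) (even , q) ,
         permute π⁻ x , Equivalence.from (ℋ⇔ {r}) (trans (parity-permute π⁻ x) even , p) , permute-flip π x

    from′ : ℋ r ∩ ρ[ℋ] ρ ⊆ Kernel θ ∩ Kernel (λ x → parity x ∷ [])
    from′ (x∈ , c , c∈ , refl) =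
      let p , q = Equivalence.to (ℋ⇔ {r}) x∈
          _ , t = Equivalence.to (ℋ⇔ {r}) c∈
      in trans (cong₂ _++_ (trans (cong (syndrome r) (permute-flip π⁻ c)) t) q) (𝟎++𝟎 {r}) , cong (_∷ []) p

  -- e 𝟎 lies in the kernel of θ and is odd, so ℋ ∩ ρ(ℋ) has codimension 1 there.
  Graph-dimension : to 𝟎 ≡ 𝟎 → HasDimension (ℋ r ∩ ρ[ℋ] ρ) d →
                    ∃[ w ] HasDimension (Span (Graph ρ)) w × d + 1 + w ≡ 2 ^ r
  Graph-dimension ρ-𝟎 ℋ-dim =
    let w , im-dim = Image-dimension θ-⊕
    in w , HasDimension-resp θ-image im-dim , rank-nullity θ-⊕
         (dimension-extension {f = λ x → parity x ∷ []} parity-additive (preimage-subspace θ-⊕ zero-subspace)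
           (HasDimension-resp (proj₂ θ-kernel , proj₁ θ-kernel) ℋ-dim)
           (HasDimension-resp
             ((λ { {false ∷ []} _ → 𝟎 , additive-𝟎 θ-⊕ , cong (_∷ []) (parity-𝟎 {2 ^ r})
                 ; {true ∷ []} _ → e (𝟎 {r}) , trans (θ-e 𝟎) (trans (cong (_++ 𝟎) from-𝟎) (𝟎++𝟎 {r})) ,
                                   cong (_∷ []) (parity-unit (index (𝟎 {r}))) }) , _)
             full-dimension))
         im-dim
    where
    from-𝟎 : from 𝟎 ≡ 𝟎
    from-𝟎 = trans (cong from (sym ρ-𝟎)) (Inverse.strictlyInverseʳ ρ 𝟎)

-- Direct sums

dimension-× : {V : Pred (F^ m) 0ℓ} {W : Pred (F^ n) 0ℓ} → HasDimension V k → HasDimension W l →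
              HasDimension ((V ∘ take m) ∩ (W ∘ drop m)) (k + l)
dimension-× {m} {n} {V = V} {W} V-dim W-dim = dimension-extension (drop-⊕ m)
  (∩-subspace (preimage-subspace (take-⊕ m) V-sub) (preimage-subspace (drop-⊕ m) W-sub))
  (HasDimension-resp
    ((λ { (x , x∈ , refl) →
       (subst V (sym (take-++ x 𝟎)) x∈ , subst W (sym (drop-++ x 𝟎)) (𝟎-closed W-sub)) , drop-++ x 𝟎 }) ,
     λ {z} ((x∈ , _) , eq) → take m z , x∈ , trans (cong (take m z ++_) (sym eq)) (take++drop≡id m z))
    (dimension-image (++𝟎-⊕ m n) (λ {x} eq → proj₁ (++-injective x 𝟎 (trans eq (sym (𝟎++𝟎 {m}))))) V-dim))
  (HasDimension-resp
    ((λ {y} y∈ → 𝟎 ++ y , (subst V (sym (take-++ (𝟎 {m}) y)) (𝟎-closed V-sub) , subst W (sym (drop-++ (𝟎 {m}) y)) y∈) , drop-++ (𝟎 {m}) y) ,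
     λ { (_ , (_ , y∈) , refl) → y∈ })
    W-dim)
  where
  V-sub = dimension⇒subspace V-dim
  W-sub = dimension⇒subspace W-dim

module _ (k l m n : ℕ) where

  -- The points of the graph of τ|σ are (a₁ | a₂) | (τ(a₁) | σ(a₂)). Exchanging the middle blocks
  -- turns them into pairs of points of the two graphs.
  interchange : F^ ((k + l) + (m + n)) → F^ ((k + m) + (l + n))
  interchange v =
    (take k (take (k + l) v) ++ take m (drop (k + l) v)) ++ (drop k (take (k + l) v) ++ drop m (drop (k + l) v))

  interchange-⊕ : Additive interchange
  interchange-⊕ = ++-additive
    (++-additive (∘-additive (take-⊕ k) (take-⊕ (k + l))) (∘-additive (take-⊕ m) (drop-⊕ (k + l))))
    (++-additive (∘-additive (drop-⊕ k) (take-⊕ (k + l))) (∘-additive (drop-⊕ m) (drop-⊕ (k + l))))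

  interchange-++ : (a : F^ k) (b : F^ l) (c : F^ m) (d : F^ n) → interchange ((a ++ b) ++ (c ++ d)) ≡ (a ++ c) ++ (b ++ d)
  interchange-++ a b c d
    rewrite take-++ (a ++ b) (c ++ d) | drop-++ (a ++ b) (c ++ d) | take-++ a b | drop-++ a b | take-++ c d | drop-++ c d
    = refl

interchange-involutive : ∀ k l m n v → interchange k l m n (interchange k m l n v) ≡ v
interchange-involutive k l m n v with splitAt (k + m) v
... | ab , cd , refl with splitAt k ab | splitAt l cd
... | a , b , refl | c , d , refl = interchange-++ k l m n a c b d

module _ {r₁ r₂ : ℕ} (τ : F^ r₁ ↔ F^ r₁) (σ : F^ r₂ ↔ F^ r₂) where
  private
    module τ = Inverse τ
    module σ = Inverse σ
    ρ = τ ∥ σ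
    R = r₁ + r₂

  ∥-++ : ∀ a b → Inverse.to ρ (a ++ b) ≡ τ.to a ++ σ.to b
  ∥-++ a b = cong₂ (λ a b → τ.to a ++ σ.to b) (take-++ a b) (drop-++ a b)

  AdditiveAt-∥ : (AdditiveAt τ.to ∘ take r₁) ∩ (AdditiveAt σ.to ∘ drop r₁) ≐ AdditiveAt (Inverse.to ρ)
  AdditiveAt-∥ =
    (λ {a} (τ-add , σ-add) b → trans
      (cong₂ _++_
        (trans (cong τ.to (take-⊕ r₁ a b)) (τ-add (take r₁ b)))
        (trans (cong σ.to (drop-⊕ r₁ a b)) (σ-add (drop r₁ b))))
      (++-⊕ (τ.to (take r₁ a)) (τ.to (take r₁ b)) (σ.to (drop r₁ a)) (σ.to (drop r₁ b)))) ,
    -- Test vectors with one half `𝟎` separate the two conditions.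
    λ {a} add → (λ b → proj₁ (components a add b 𝟎)) , (λ c → proj₂ (components a add 𝟎 c))
    where
    components : ∀ a → AdditiveAt (Inverse.to ρ) a → ∀ b c →
                 τ.to (take r₁ a ⊕ b) ≡ τ.to (take r₁ a) ⊕ τ.to b ×
                 σ.to (drop r₁ a ⊕ c) ≡ σ.to (drop r₁ a) ⊕ σ.to c
    components a add b c = ++-injective _ _ (begin
      τ.to (a₁ ⊕ b) ++ σ.to (a₂ ⊕ c)
        ≡⟨ cong₂ (λ x y → τ.to x ++ σ.to y)
             (trans (take-⊕ r₁ a (b ++ c)) (cong (a₁ ⊕_) (take-++ b c)))
             (trans (drop-⊕ r₁ a (b ++ c)) (cong (a₂ ⊕_) (drop-++ b c))) ⟨
      Inverse.to ρ (a ⊕ (b ++ c))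
        ≡⟨ add (b ++ c) ⟩
      Inverse.to ρ a ⊕ Inverse.to ρ (b ++ c)
        ≡⟨ cong (Inverse.to ρ a ⊕_) (∥-++ b c) ⟩
      (τ.to a₁ ++ σ.to a₂) ⊕ (τ.to b ++ σ.to c)
        ≡⟨ ++-⊕ (τ.to a₁) (τ.to b) (σ.to a₂) (σ.to c) ⟨
      (τ.to a₁ ⊕ τ.to b) ++ (σ.to a₂ ⊕ σ.to c) ∎)
      where
      open ≡-Reasoning
      a₁ = take r₁ a
      a₂ = drop r₁ a

  module _ (τ-𝟎 : τ.to 𝟎 ≡ 𝟎) (σ-𝟎 : σ.to 𝟎 ≡ 𝟎) where
    open ≡-Reasoning
    private
      f : F^ (R + R) → F^ ((r₁ + r₁) + (r₂ + r₂))
      f = interchange r₁ r₂ r₁ r₂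

      g : F^ ((r₁ + r₁) + (r₂ + r₂)) → F^ (R + R)
      g = interchange r₁ r₁ r₂ r₂

      V : Pred (F^ ((r₁ + r₁) + (r₂ + r₂))) 0ℓ
      V = (Span (Graph τ) ∘ take (r₁ + r₁)) ∩ (Span (Graph σ) ∘ drop (r₁ + r₁))

      V-sub : IsSubspace V
      V-sub = ∩-subspace (preimage-subspace (take-⊕ (r₁ + r₁)) Span-subspace)
                         (preimage-subspace (drop-⊕ (r₁ + r₁)) Span-subspace)

      Graph-⊆ : Graph ρ ⊆ V ∘ f
      Graph-⊆ (a , refl) with splitAt r₁ a
      ... | a₁ , a₂ , refl rewrite interchange-++ r₁ r₂ r₁ r₂ a₁ a₂ (τ.to a₁) (σ.to a₂)
                                 | take-++ (a₁ ++ τ.to a₁) (a₂ ++ σ.to a₂) | drop-++ (a₁ ++ τ.to a₁) (a₂ ++ σ.to a₂)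
        = ⊆-Span (a₁ , refl) , ⊆-Span (a₂ , refl)

      g-++𝟎 : Additive (λ w → g (w ++ 𝟎))
      g-++𝟎 = ∘-additive {f = g} {_++ 𝟎} (interchange-⊕ r₁ r₁ r₂ r₂) (++𝟎-⊕ (r₁ + r₁) (r₂ + r₂))

      g-𝟎++ : Additive (λ w → g (𝟎 {r₁ + r₁} ++ w))
      g-𝟎++ = ∘-additive {f = g} {𝟎 {r₁ + r₁} ++_} (interchange-⊕ r₁ r₁ r₂ r₂) (𝟎++-⊕ (r₁ + r₁) (r₂ + r₂))

      -- Because τ and σ fix `𝟎`, each graph padded with zeros is part of the graph of τ|σ, whose
      -- span therefore contains both summands.
      Span-⊇ : V ∘ f ⊆ Span (Graph ρ)
      Span-⊇ {v} (v₁∈ , v₂∈) = subst (Span (Graph ρ)) eq (⊕-closed Span-subspace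
        (Span-minimal (preimage-subspace g-++𝟎 Span-subspace)
          (λ { (a , refl) → ⊆-Span (a ++ 𝟎 , (begin
            (a ++ 𝟎) ++ Inverse.to ρ (a ++ 𝟎)      ≡⟨ cong ((a ++ 𝟎) ++_) (trans (∥-++ a 𝟎) (cong (τ.to a ++_) σ-𝟎)) ⟩
            (a ++ 𝟎) ++ (τ.to a ++ 𝟎)              ≡⟨ interchange-++ r₁ r₁ r₂ r₂ a (τ.to a) 𝟎 𝟎 ⟨
            g ((a ++ τ.to a) ++ (𝟎 {r₂} ++ 𝟎))     ≡⟨ cong (λ u → g ((a ++ τ.to a) ++ u)) (𝟎++𝟎 {r₂}) ⟩
            g ((a ++ τ.to a) ++ 𝟎)                 ∎)) }) v₁∈)
        (Span-minimal (preimage-subspace g-𝟎++ Span-subspace)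
          (λ { (a , refl) → ⊆-Span (𝟎₁ ++ a , (begin
            (𝟎₁ ++ a) ++ Inverse.to ρ (𝟎₁ ++ a)    ≡⟨ cong ((𝟎₁ ++ a) ++_) (trans (∥-++ 𝟎₁ a) (cong (_++ σ.to a) τ-𝟎)) ⟩
            (𝟎₁ ++ a) ++ (𝟎₁ ++ σ.to a)            ≡⟨ interchange-++ r₁ r₁ r₂ r₂ 𝟎₁ 𝟎₁ a (σ.to a) ⟨
            g ((𝟎₁ ++ 𝟎₁) ++ (a ++ σ.to a))        ≡⟨ cong (λ u → g (u ++ (a ++ σ.to a))) (𝟎++𝟎 {r₁}) ⟩
            g (𝟎 {r₁ + r₁} ++ (a ++ σ.to a))       ∎)) }) v₂∈))
        where
        𝟎₁ = 𝟎 {r₁}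
        v₁ = take (r₁ + r₁) (f v)
        v₂ = drop (r₁ + r₁) (f v)

        eq : g (v₁ ++ 𝟎) ⊕ g (𝟎 {r₁ + r₁} ++ v₂) ≡ v
        eq = begin
          g (v₁ ++ 𝟎) ⊕ g (𝟎 {r₁ + r₁} ++ v₂)      ≡⟨ interchange-⊕ r₁ r₁ r₂ r₂ (v₁ ++ 𝟎) (𝟎 {r₁ + r₁} ++ v₂) ⟨
          g ((v₁ ++ 𝟎) ⊕ (𝟎 {r₁ + r₁} ++ v₂))      ≡⟨ cong g (++-⊕ v₁ 𝟎 𝟎 v₂) ⟨
          g ((v₁ ⊕ 𝟎) ++ (𝟎 ⊕ v₂))       ≡⟨ cong g (cong₂ _++_ (⊕-identityʳ v₁) (⊕-identityˡ v₂)) ⟩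
          g (v₁ ++ v₂)                   ≡⟨ cong g (take++drop≡id (r₁ + r₁) (f v)) ⟩
          g (f v)                        ≡⟨ interchange-involutive r₁ r₁ r₂ r₂ v ⟩
          v                              ∎

    Graph-dimension-∥ : HasDimension (Span (Graph τ)) k → HasDimension (Span (Graph σ)) l →
                        HasDimension (Span (Graph ρ)) (k + l)
    Graph-dimension-∥ τ-dim σ-dim = HasDimension-resp
      (Span-⊇ , Span-minimal (preimage-subspace (interchange-⊕ r₁ r₂ r₁ r₂) V-sub) Graph-⊆)
      (dimension-preimage (interchange-⊕ r₁ r₂ r₁ r₂) (λ w → g w , interchange-involutive r₁ r₂ r₁ r₂ w)
        (HasDimension-resp
          ((λ { refl → additive-𝟎 (interchange-⊕ r₁ r₂ r₁ r₂) }) ,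
           λ {v} eq → trans (sym (interchange-involutive r₁ r₁ r₂ r₂ v))
             (trans (cong g eq) (additive-𝟎 (interchange-⊕ r₁ r₁ r₂ r₂))))
          zero-dimension)
        (dimension-× τ-dim σ-dim))

-- Deficiency

index-injective : {a b : F^ r} → index a ≡ index b → a ≡ b
index-injective {r} {a} {b} eq = trans (sym (vector-index a)) (trans (cong (vector r) eq) (vector-index b))

infix 4 _∈ₜ_
_∈ₜ_ : F^ r → F^ r × F^ r × F^ r → Set
x ∈ₜ (a , b , c) = x ≡ a ⊎ x ≡ b ⊎ x ≡ c

∈-triple⇔ : {x a b c : F^ r} → index x Subset.∈ triple a b c ⇔ x ∈ₜ (a , b , c)
∈-triple⇔ {x = x} {a} {b} {c} = mk⇔ to from
  where
  ∈⁅⁆⇒≡ : ∀ {y} → index x Subset.∈ ⁅ index y ⁆ → x ≡ y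
  ∈⁅⁆⇒≡ x∈ = index-injective (x∈⁅y⁆⇒x≡y _ x∈)

  to : index x Subset.∈ triple a b c → x ∈ₜ (a , b , c)
  to x∈ with x∈p∪q⁻ ⁅ index a ⁆ (⁅ index b ⁆ ∪ ⁅ index c ⁆) x∈
  ... | inj₁ x∈a = inj₁ (∈⁅⁆⇒≡ x∈a)
  ... | inj₂ x∈bc with x∈p∪q⁻ ⁅ index b ⁆ ⁅ index c ⁆ x∈bc
  ...   | inj₁ x∈b = inj₂ (inj₁ (∈⁅⁆⇒≡ x∈b))
  ...   | inj₂ x∈c = inj₂ (inj₂ (∈⁅⁆⇒≡ x∈c))

  from : x ∈ₜ (a , b , c) → index x Subset.∈ triple a b c
  from (inj₁ refl)        = x∈p∪q⁺ (inj₁ (x∈⁅x⁆ _))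
  from (inj₂ (inj₁ refl)) = x∈p∪q⁺ (inj₂ (x∈p∪q⁺ (inj₁ (x∈⁅x⁆ _))))
  from (inj₂ (inj₂ refl)) = x∈p∪q⁺ (inj₂ (x∈p∪q⁺ (inj₂ (x∈⁅x⁆ _))))

-- Apart from `a`, the triple offers only `d` and `a ⊕ d`, whose sum is `a`.
line-sum : {a b c d : F^ r} → b ≢ a → c ≢ a → c ≢ b → b ∈ₜ (a , d , a ⊕ d) → c ∈ₜ (a , d , a ⊕ d) → c ≡ a ⊕ b
line-sum b≢a c≢a c≢b (inj₁ b≡a) _ = contradiction b≡a b≢a
line-sum b≢a c≢a c≢b _ (inj₁ c≡a) = contradiction c≡a c≢a
line-sum b≢a c≢a c≢b (inj₂ (inj₁ refl)) (inj₂ (inj₁ c≡d)) = contradiction c≡d c≢b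
line-sum b≢a c≢a c≢b (inj₂ (inj₁ refl)) (inj₂ (inj₂ c≡)) = c≡
line-sum {a = a} {d = d} b≢a c≢a c≢b (inj₂ (inj₂ refl)) (inj₂ (inj₁ c≡d)) = trans c≡d (sym (⊕-cancelˡ a d))
line-sum b≢a c≢a c≢b (inj₂ (inj₂ refl)) (inj₂ (inj₂ c≡)) = contradiction c≡ c≢b

module _ {r : ℕ} (ρ : F^ r ↔ F^ r) (ρ-𝟎 : Inverse.to ρ 𝟎 ≡ 𝟎) where
  private
    f = Inverse.to ρ
    f⁻ = Inverse.from ρ

    f-injective : ∀ {a b} → f a ≡ f b → a ≡ b
    f-injective {a} {b} eq =
      trans (sym (Inverse.strictlyInverseʳ ρ a)) (trans (cong f⁻ eq) (Inverse.strictlyInverseʳ ρ b))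

  -- For `b` other than `𝟎` and `a`, the points `f b` and `f (a ⊕ b)` lie on a triple `f a`, `c`,
  -- `f a ⊕ c`; they are distinct and differ from `f a`, so `line-sum` applies. The values `𝟎` and
  -- `a`, which stars exclude, follow from `ρ-𝟎`.
  PreservesStar⇒AdditiveAt : PreservesStar ρ ⊆ AdditiveAt f
  PreservesStar⇒AdditiveAt {a} (a≢𝟎 , star⊆ , _) b with b ≟ 𝟎 | b ≟ a
  ... | yes refl | _        =
    trans (cong f (⊕-identityʳ a)) (trans (sym (⊕-identityʳ (f a))) (cong (f a ⊕_) (sym ρ-𝟎)))
  ... | no _     | yes refl = trans (cong f (⊕-same a)) (trans ρ-𝟎 (sym (⊕-same (f a))))
  ... | no b≢𝟎   | no b≢a
    with c , _ , _ , eq ← star⊆ (b , b≢𝟎 , b≢a , refl)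
    = line-sum {d = c}
        (b≢a ∘ f-injective)
        (λ p → b≢𝟎 (trans (⊕-transpose (f-injective p)) (⊕-same a)))
        (λ p → a≢𝟎 (trans (sym (⊕-cancelʳ a b)) (trans (cong (_⊕ b) (f-injective p)) (⊕-same b))))
        (on-line {f b} (inj₂ (inj₁ refl)))
        (on-line {f (a ⊕ b)} (inj₂ (inj₂ refl)))
    where
    on-line : ∀ {x} → x ∈ₜ (f a , f b , f (a ⊕ b)) → x ∈ₜ (f a , c , f a ⊕ c)
    on-line {x} = Equivalence.to ∈-triple⇔ ∘ subst (index x Subset.∈_) (sym eq) ∘ Equivalence.from ∈-triple⇔

  AdditiveAt⇒PreservesStar : ∀ {a} → a ≢ 𝟎 → AdditiveAt f a → PreservesStar ρ a
  AdditiveAt⇒PreservesStar {a} a≢𝟎 add = a≢𝟎 , ⊆-star , star-⊆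
    where
    triple-add : ∀ b → triple (f a) (f b) (f (a ⊕ b)) ≡ triple (f a) (f b) (f a ⊕ f b)
    triple-add b = cong (triple (f a) (f b)) (add b)

    ⊆-star : ρ[Star] ρ a ⊆ Star (f a)
    ⊆-star (b , b≢𝟎 , b≢a , eq) =
      f b , (λ p → b≢𝟎 (f-injective (trans p (sym ρ-𝟎)))) , b≢a ∘ f-injective , trans (sym (triple-add b)) eq

    star-⊆ : Star (f a) ⊆ ρ[Star] ρ a
    star-⊆ {t} (c , c≢𝟎 , c≢fa , eq) =
      f⁻ c , (λ p → c≢𝟎 (trans (sym f-f⁻c) (trans (cong f p) ρ-𝟎))) ,
      (λ p → c≢fa (trans (sym f-f⁻c) (cong f p))) ,
      trans (triple-add (f⁻ c)) (subst (λ c → triple (f a) c (f a ⊕ c) ≡ t) (sym f-f⁻c) eq)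
      where
      f-f⁻c : f (f⁻ c) ≡ c
      f-f⁻c = Inverse.strictlyInverseˡ ρ c

injection-count : {A : Set} {f : Fin m → A} {g : Fin n → A} → Injective _≡_ _≡_ f → (∀ i → ∃[ j ] f i ≡ g j) → m ≤ n
injection-count {f = f} {g} f-inj f⊆g = injective⇒≤ {f = proj₁ ∘ f⊆g} λ {i} {j} eq →
  f-inj (trans (proj₂ (f⊆g i)) (trans (cong g eq) (sym (proj₂ (f⊆g j)))))

-- Two injective lists exhaust `V`: `g` puts `𝟎` before the counted nonzero vectors, and `h` runs
-- through the combinations of a basis. Each is contained in the other.
nonzero-count : {P V : Pred (F^ r) 0ℓ} → (∀ {x} → P x ⇔ (x ≢ 𝟎 × V x)) →
                HasSize (SubsetSetoid P) n → HasDimension V d → n + 1 ≡ 2 ^ d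
nonzero-count {r} {n} {d} {P} {V} P⇔ size V-dim@(vs , ind , V⊆ , ⊆V) = trans (ℕ.+-comm n 1)
  (ℕ.≤-antisym (injection-count g-injective g⊆h) (injection-count h-injective h⊆g))
  where
  open Inverse size using (to; from; to-cong; strictlyInverseˡ; strictlyInverseʳ)

  g : Fin (suc n) → F^ r
  g zero    = 𝟎
  g (suc i) = proj₁ (from i)

  h : Fin (2 ^ d) → F^ r
  h i = vs · vector d i

  from≢𝟎 : ∀ i → proj₁ (from i) ≢ 𝟎
  from≢𝟎 i = proj₁ (Equivalence.to P⇔ (proj₂ (from i)))

  g-injective : Injective _≡_ _≡_ g
  g-injective {zero}  {zero}  _  = refl
  g-injective {zero}  {suc j} eq = contradiction (sym eq) (from≢𝟎 j)
  g-injective {suc i} {zero}  eq = contradiction eq (from≢𝟎 i)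
  g-injective {suc i} {suc j} eq = cong suc (trans (sym (strictlyInverseˡ i)) (trans (to-cong eq) (strictlyInverseˡ j)))

  h-injective : Injective _≡_ _≡_ h
  h-injective {i} {j} eq = trans (sym (index-vector {d} i)) (trans (cong index (⊕≡𝟎⇒≡ (ind _
    (trans (·-⊕ vs (vector d i) (vector d j)) (trans (cong (_⊕ h j) eq) (⊕-same (h j))))))) (index-vector {d} j))

  V⊆h : ∀ {x} → V x → ∃[ j ] x ≡ h j
  V⊆h x∈ = let y , eq = V⊆ x∈ in index y , trans (sym eq) (cong (vs ·_) (sym (vector-index y)))

  g⊆h : ∀ i → ∃[ j ] g i ≡ h j
  g⊆h zero    = V⊆h (𝟎-closed (dimension⇒subspace V-dim))
  g⊆h (suc i) = V⊆h (proj₂ (Equivalence.to P⇔ (proj₂ (from i))))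

  h⊆g : ∀ i → ∃[ j ] h i ≡ g j
  h⊆g i with h i ≟ 𝟎
  ... | yes eq = zero , eq
  ... | no ≢𝟎  = suc (to hi) , sym (strictlyInverseʳ hi)
    where
    hi : ∃ P
    hi = h i , Equivalence.from P⇔ (≢𝟎 , ⊆V (vector d i , refl))

-- `nonzero-count` shows that n + 1 is 2 ^ d, so the rounded logarithm returns d exactly.
deficiency⇒dimension : (ρ : F^ r ↔ F^ r) → Inverse.to ρ 𝟎 ≡ 𝟎 → {k : ℤ} → IsDeficiency ρ k →
                       ∃[ d ] HasDimension (AdditiveAt (Inverse.to ρ)) d × k ≡ + r ℤ.- + d
deficiency⇒dimension {r} ρ ρ-𝟎 (n , size , refl)
  with d , A-dim ← dimension-exists (AdditiveAt? (Inverse.to ρ)) (AdditiveAt-subspace ρ-𝟎)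
  = d , A-dim , cong (λ t → + r ℤ.- + t) (trans (cong ⌊log₂_⌋ count) (⌊log₂[2^n]⌋≡n d))
  where
  count : n + 1 ≡ 2 ^ d
  count = nonzero-count (mk⇔ (λ p → proj₁ p , PreservesStar⇒AdditiveAt ρ ρ-𝟎 p)
    (λ (a≢𝟎 , add) → AdditiveAt⇒PreservesStar ρ ρ-𝟎 a≢𝟎 add)) size A-dim

-- Extended perfect codes

wt-𝟎 : wt (𝟎 {n}) ≡ 0
wt-𝟎 {zero}  = refl
wt-𝟎 {suc n} = wt-𝟎 {n}

wt-unit : (i : Fin n) → wt (unit i) ≡ 1
wt-unit {suc n} zero    = cong suc (wt-𝟎 {n})
wt-unit         (suc i) = wt-unit i

wt≤0⇒≡𝟎 : (x : F^ n) → wt x ≤ 0 → x ≡ 𝟎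
wt≤0⇒≡𝟎 []          _  = refl
wt≤0⇒≡𝟎 (false ∷ x) ≤0 = cong (false ∷_) (wt≤0⇒≡𝟎 x ≤0)

wt≤1⇒unit : (x : F^ n) → wt x ≤ 1 → x ≡ 𝟎 ⊎ ∃[ i ] x ≡ unit i
wt≤1⇒unit []          _        = inj₁ refl
wt≤1⇒unit (true ∷ x)  (s≤s ≤0) = inj₂ (zero , cong (true ∷_) (wt≤0⇒≡𝟎 x ≤0))
wt≤1⇒unit (false ∷ x) ≤1 with wt≤1⇒unit x ≤1
... | inj₁ eq       = inj₁ (cong (false ∷_) eq)
... | inj₂ (i , eq) = inj₂ (suc i , cong (false ∷_) eq)

extend : F^ n → F^ (suc n)
extend x = parity x ∷ x

extend-⊕ : Additive (extend {n})
extend-⊕ x y = cong (_∷ (x ⊕ y)) (parity-⊕ x y)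

extend-even : (x : F^ n) → parity (extend x) ≡ false
extend-even x = Bool.xor-same (parity x)

even⇒extend : (s : Bool) (x : F^ n) → parity (s ∷ x) ≡ false → s ∷ x ≡ extend x
even⇒extend s x eq = cong (_∷ x) (∷-injectiveˡ (⊕≡𝟎⇒≡ {x = s ∷ []} {parity x ∷ []} (cong (_∷ []) eq)))

-- The second unit vector covers both weights: `j = zero` stands for weight 0, where the two unit
-- vectors cancel, and `j = suc i` for `unit i`, whose parity bit is `unit zero`.
wt≤1⇔ : {x : F^ n} → wt x ≤ 1 ⇔ (∃[ j ] extend x ≡ unit zero ⊕ unit j)
wt≤1⇔ {n} {x} = mk⇔ to from
  where
  to : wt x ≤ 1 → ∃[ j ] extend x ≡ unit zero ⊕ unit j
  to ≤1 with wt≤1⇒unit x ≤1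
  ... | inj₁ refl       = zero , cong₂ _∷_ (parity-𝟎 {n}) (sym (⊕-same 𝟎))
  ... | inj₂ (i , refl) = suc i , cong₂ _∷_ (parity-unit i) (sym (⊕-identityˡ (unit i)))

  from : (∃[ j ] extend x ≡ unit zero ⊕ unit j) → wt x ≤ 1
  from (zero  , eq) = ℕ.≤-trans (ℕ.≤-reflexive (trans (cong wt (trans (∷-injectiveʳ eq) (⊕-same 𝟎))) (wt-𝟎 {n}))) z≤n
  from (suc i , eq) = ℕ.≤-reflexive (trans (cong wt (trans (∷-injectiveʳ eq) (⊕-identityˡ (unit i)))) (wt-unit i))

distance≤1⇔ : {x y : F^ n} → distance x y ≤ 1 ⇔ (∃[ j ] extend y ≡ extend x ⊕ unit zero ⊕ unit j)
distance≤1⇔ {x = x} {y} = mk⇔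
  (λ ≤1 → let j , eq = Equivalence.to wt≤1⇔ ≤1 in
    j , trans (⊕-transpose (trans (sym (extend-⊕ x y)) eq)) (sym (⊕-assoc (extend x) (unit zero) (unit j))))
  (λ (j , eq) → Equivalence.from wt≤1⇔ (j , trans (extend-⊕ x y)
    (sym (⊕-transpose (sym (trans eq (⊕-assoc (extend x) (unit zero) (unit j))))))))

-- An even vector and a codeword at distance at most 2 that differ in the
-- coordinate i whenever they differ correspond, after deleting the coordinate i,
-- to a vector and a codeword at distance at most 1.
extendedPerfect : {C : Code n} (i : Fin n) → toℕ i ≡ 0 → (∀ {z} → C z → parity z ≡ false) →
                  (∀ x → parity x ≡ false → ∃! _≡_ λ j → C (x ⊕ unit i ⊕ unit j)) → ExtendedPerfect C
extendedPerfect {suc m} {C} zero _ C-even near = m , C ∘ extend , refl , zero , perfect , C⊆ , ⊆C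
  where
  perfect : Perfect (C ∘ extend)
  perfect x
    with j , z∈ , unique ← near (extend x) (extend-even x)
    with s ∷ y ← extend x ⊕ unit zero ⊕ unit j in z-eq
    = y , (subst C z≡ z∈ , Equivalence.from distance≤1⇔ (j , sym (trans z-eq z≡))) ,
      λ {y′} (y′∈ , y′-near) → let j′ , eq = Equivalence.to (distance≤1⇔ {x = x} {y′}) y′-near in
        ∷-injectiveʳ (trans (sym z-eq) (trans (cong (λ j → extend x ⊕ unit zero ⊕ unit j) (unique (subst C eq y′∈))) (sym eq)))
    where
    z≡ : s ∷ y ≡ extend y
    z≡ = even⇒extend s y (C-even z∈)

  C⊆ : C ⊆ λ x → ∃[ y ] addParity zero (C ∘ extend) y × cast refl y ≡ x
  C⊆ {s ∷ x} x∈ = s ∷ x , (x , subst C eq x∈ , sym eq) , cast-is-id refl (s ∷ x)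
    where
    eq : s ∷ x ≡ extend x
    eq = even⇒extend s x (C-even x∈)

  ⊆C : (λ x → ∃[ y ] addParity zero (C ∘ extend) y × cast refl y ≡ x) ⊆ C
  ⊆C (_ , (x , x∈ , refl) , refl) = subst C (sym (cast-is-id refl (extend x))) x∈

↑-cases : (P : Fin (m + n) → Set) → (∀ i → P (i ↑ˡ n)) → (∀ j → P (m ↑ʳ j)) → ∀ k → P k
↑-cases {m} {n} P pˡ pʳ k with Fin.splitAt m k | join-splitAt m n k
... | inj₁ i | refl = pˡ i
... | inj₂ j | refl = pʳ j

unit-↑ˡ : (i : Fin m) → unit (i ↑ˡ n) ≡ unit i ++ 𝟎
unit-↑ˡ {suc m} zero    = cong (true ∷_) (sym (𝟎++𝟎 {m}))
unit-↑ˡ         (suc i) = cong (false ∷_) (unit-↑ˡ i)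

unit-↑ʳ : ∀ m (i : Fin n) → unit (m ↑ʳ i) ≡ 𝟎 {m} ++ unit i
unit-↑ʳ zero    i = refl
unit-↑ʳ (suc m) i = cong (false ∷_) (unit-↑ʳ m i)

parity-++ : (x : F^ m) (y : F^ n) → parity (x ++ y) ≡ parity x xor parity y
parity-++ []      y = refl
parity-++ (s ∷ x) y = trans (cong (s xor_) (parity-++ x y)) (sym (Bool.xor-assoc s (parity x) (parity y)))

parity-halves : ∀ m (z : F^ (m + n)) → parity z ≡ parity (take m z) xor parity (drop m z)
parity-halves m z = trans (cong parity (sym (take++drop≡id m z))) (parity-++ (take m z) (drop m z))

-- `2 ^ r + 2 ^ r` is not syntactically a successor, so the first coordinate is recognised by its
-- value in ℕ.
toℕ-index-𝟎 : ∀ r → toℕ (index (𝟎 {r})) ≡ 0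
toℕ-index-𝟎 zero    = refl
toℕ-index-𝟎 (suc r) = trans (toℕ-↑ˡ (index (𝟎 {r})) _) (toℕ-index-𝟎 r)

module _ {r : ℕ} (ρ : F^ r ↔ F^ r) where
  private
    N  = 2 ^ r
    f  = Inverse.to ρ
    f⁻ = Inverse.from ρ
    i₀ = index (𝟎 {r}) ↑ˡ N

  syndromes-↑ˡ : ∀ c → syndromes r (unit (index c ↑ˡ N)) ≡ true ∷ false ∷ (c ++ 𝟎)
  syndromes-↑ˡ c = trans (cong (syndromes r) (unit-↑ˡ (index c))) (trans (syndromes-++ r (e c) 𝟎)
    (cong₂ _∷_ (parity-unit (index c)) (cong₂ _∷_ (parity-𝟎 {N}) (cong₂ _++_ (syndrome-e c) (additive-𝟎 (syndrome-⊕ r))))))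

  syndromes-↑ʳ : ∀ c → syndromes r (unit (N ↑ʳ index c)) ≡ false ∷ true ∷ (𝟎 ++ c)
  syndromes-↑ʳ c = trans (cong (syndromes r) (unit-↑ʳ N (index c))) (trans (syndromes-++ r 𝟎 (e c))
    (cong₂ _∷_ (parity-𝟎 {N}) (cong₂ _∷_ (parity-unit (index c)) (cong₂ _++_ (additive-𝟎 (syndrome-⊕ r)) (syndrome-e c)))))

  Sℋ⇔ : ∀ {z p q} {a b : F^ r} → syndromes r z ≡ p ∷ q ∷ (a ++ b) → Sℋ ρ z ⇔ (p ≡ false × q ≡ false × f a ≡ b)
  Sℋ⇔ {z} {p} {q} {a} {b} eq = mk⇔ to from
    where
    to : Sℋ ρ z → p ≡ false × q ≡ false × f a ≡ b
    to z∈ with w , w∈ , eq′ ← proj₁ (Sℋ≐ ρ) z∈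
          with refl , eq″ ← ∷-injective (trans eq′ eq)
          with refl , refl ← ∷-injective eq″ = refl , refl , Graph⁻ {ρ = ρ} w∈

    from : p ≡ false × q ≡ false × f a ≡ b → Sℋ ρ z
    from (refl , refl , refl) = proj₂ (Sℋ≐ ρ) (_ , (a , refl) , sym eq)

  Sℋ-even : ∀ {z} → Sℋ ρ z → parity z ≡ false
  Sℋ-even {z} z∈ with w , w∈ , eq ← proj₁ (Sℋ≐ ρ) z∈ with p , eq′ ← ∷-injective eq =
    trans (parity-halves N z) (cong₂ _xor_ (sym p) (sym (∷-injectiveˡ eq′)))

  module _ (x : F^ (N + N)) {p} {a b : F^ r} (x-eq : syndromes r x ≡ p ∷ p ∷ (a ++ b)) where
    private
      syndromes-shift : ∀ {w} j → syndromes r (unit j) ≡ w →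
                        syndromes r (x ⊕ unit i₀ ⊕ unit j) ≡ ((p ∷ p ∷ (a ++ b)) ⊕ (true ∷ false ∷ 𝟎)) ⊕ w
      syndromes-shift j refl = trans (syndromes-⊕ r (x ⊕ unit i₀) (unit j)) (cong (_⊕ syndromes r (unit j))
        (trans (syndromes-⊕ r x (unit i₀)) (cong₂ _⊕_ x-eq
          (trans (syndromes-↑ˡ 𝟎) (cong (λ w → true ∷ false ∷ w) (𝟎++𝟎 {r}))))))

    -- Two flips on the left keep the left parity and add `c` to the left syndrome, so both halves
    -- of `x` must already be even.
    shift-↑ˡ : ∀ c → Sℋ ρ (x ⊕ unit i₀ ⊕ unit (index c ↑ˡ N)) ⇔ (p ≡ false × f (a ⊕ c) ≡ b)
    shift-↑ˡ c = mk⇔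
      (λ z∈ → let _ , q , eq = Equivalence.to (Sℋ⇔ z-eq) z∈ in q , eq)
      (λ (q , eq) → Equivalence.from (Sℋ⇔ z-eq) (q , q , eq))
      where
      z-eq : syndromes r (x ⊕ unit i₀ ⊕ unit (index c ↑ˡ N)) ≡ p ∷ p ∷ ((a ⊕ c) ++ b)
      z-eq = trans (syndromes-shift _ (syndromes-↑ˡ c)) (cong₂ _∷_ (∷-injectiveˡ (⊕-cancelʳ (p ∷ []) (true ∷ [])))
        (cong₂ _∷_ (∷-injectiveˡ (trans (⊕-identityʳ _) (⊕-identityʳ (p ∷ []))))
          (trans (cong (_⊕ (c ++ 𝟎)) (⊕-identityʳ (a ++ b)))
            (trans (sym (++-⊕ a c b 𝟎)) (cong ((a ⊕ c) ++_) (⊕-identityʳ b))))))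

    -- Here each half has one coordinate flipped, so both halves of `x` must be odd; `i₀` has index
    -- `𝟎` and leaves the left syndrome alone.
    shift-↑ʳ : ∀ c → Sℋ ρ (x ⊕ unit i₀ ⊕ unit (N ↑ʳ index c)) ⇔ (p ≡ true × f a ≡ b ⊕ c)
    shift-↑ʳ c = mk⇔
      (λ z∈ → let q , _ , eq = Equivalence.to (Sℋ⇔ z-eq) z∈ in Bool.not-injective (trans (sym (Bool.xor-comm p true)) q) , eq)
      (λ { (refl , eq) → Equivalence.from (Sℋ⇔ z-eq) (refl , refl , eq) })
      where
      z-eq : syndromes r (x ⊕ unit i₀ ⊕ unit (N ↑ʳ index c)) ≡ (p xor true) ∷ (p xor true) ∷ (a ++ (b ⊕ c))
      z-eq = trans (syndromes-shift _ (syndromes-↑ʳ c)) (cong₂ _∷_ (∷-injectiveˡ (⊕-identityʳ ((p xor true) ∷ [])))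
        (cong₂ _∷_ (cong (_xor true) (∷-injectiveˡ (⊕-identityʳ (p ∷ []))))
          (trans (cong (_⊕ (𝟎 ++ c)) (⊕-identityʳ (a ++ b)))
            (trans (sym (++-⊕ a 𝟎 b c)) (cong (_++ (b ⊕ c)) (⊕-identityʳ a))))))

  private
    data Block : Fin (N + N) → Set where
      left  : (c : F^ r) → Block (index c ↑ˡ N)
      right : (c : F^ r) → Block (N ↑ʳ index c)

    block : ∀ j → Block j
    block = ↑-cases Block
      (λ i → subst (λ i → Block (i ↑ˡ N)) (index-vector {r} i) (left (vector r i)))
      (λ i → subst (λ i → Block (N ↑ʳ i)) (index-vector {r} i) (right (vector r i)))

    -- The witnesses solve ρ(a + c) = b and ρ(a) = b + c for c.
    near-exists : ∀ x p (a b : F^ r) → syndromes r x ≡ p ∷ p ∷ (a ++ b) → ∃[ j ] Sℋ ρ (x ⊕ unit i₀ ⊕ unit j)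
    near-exists x false a b eq = index (a ⊕ f⁻ b) ↑ˡ N , Equivalence.from (shift-↑ˡ x eq (a ⊕ f⁻ b))
      (refl , trans (cong f (⊕-cancelˡ a (f⁻ b))) (Inverse.strictlyInverseˡ ρ b))
    near-exists x true  a b eq = N ↑ʳ index (b ⊕ f a) , Equivalence.from (shift-↑ʳ x eq (b ⊕ f a))
      (refl , sym (⊕-cancelˡ b (f a)))

    near-unique : ∀ x p (a b : F^ r) → syndromes r x ≡ p ∷ p ∷ (a ++ b) → ∀ {j k} →
                  Sℋ ρ (x ⊕ unit i₀ ⊕ unit j) → Sℋ ρ (x ⊕ unit i₀ ⊕ unit k) → j ≡ k
    near-unique x p a b eq {j} {k} j∈ k∈ with block j | block k
    ... | left c  | left c′  =
      let _ , s = Equivalence.to (shift-↑ˡ x {a = a} {b} eq c) j∈ ; _ , t = Equivalence.to (shift-↑ˡ x {a = a} {b} eq c′) k∈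
          fa≡ = trans s (sym t)
      in cong (λ c → index c ↑ˡ N) (trans (⊕-transpose {x = a} (trans (sym (Inverse.strictlyInverseʳ ρ (a ⊕ c)))
           (trans (cong f⁻ fa≡) (Inverse.strictlyInverseʳ ρ (a ⊕ c′))))) (⊕-cancelˡ a c′))
    ... | right c | right c′ =
      let _ , s = Equivalence.to (shift-↑ʳ x {a = a} {b} eq c) j∈ ; _ , t = Equivalence.to (shift-↑ʳ x {a = a} {b} eq c′) k∈
      in cong (λ c → N ↑ʳ index c) (trans (⊕-transpose {x = b} (trans (sym s) t)) (⊕-cancelˡ b c′))
    -- A left coordinate forces `p ≡ false`, a right one `p ≡ true`.
    ... | left c  | right c′ with refl , _ ← Equivalence.to (shift-↑ˡ x {a = a} {b} eq c) j∈
                             with () , _ ← Equivalence.to (shift-↑ʳ x {a = a} {b} eq c′) k∈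
    ... | right c | left c′  with refl , _ ← Equivalence.to (shift-↑ʳ x {a = a} {b} eq c) j∈
                             with () , _ ← Equivalence.to (shift-↑ˡ x {a = a} {b} eq c′) k∈

  Sℋ-extendedPerfect : ExtendedPerfect (Sℋ ρ)
  Sℋ-extendedPerfect = extendedPerfect i₀ (trans (toℕ-↑ˡ (index (𝟎 {r})) N) (toℕ-index-𝟎 r)) Sℋ-even λ x x-even →
    -- An even `x` has halves of equal parity, the common `p` of the lemmas above.
    let p≡q = ∷-injectiveˡ (⊕≡𝟎⇒≡ {x = parity (take N x) ∷ []} {parity (drop N x) ∷ []}
                (cong (_∷ []) (trans (sym (parity-halves N x)) x-even)))
        eq  = cong (λ q → parity (take N x) ∷ q ∷ (syndrome r (take N x) ++ syndrome r (drop N x))) (sym p≡q)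
        j , j∈ = near-exists x (parity (take N x)) (syndrome r (take N x)) (syndrome r (drop N x)) eq
    in j , j∈ , near-unique x (parity (take N x)) (syndrome r (take N x)) (syndrome r (drop N x)) eq j∈

-- Finite sets

module _ {a b ℓ₁ ℓ₂} {X : Setoid a ℓ₁} {Y : Setoid b ℓ₂} where
  private
    module X = Setoid X
    module Y = Setoid Y

  mkInverse : (to : X.Carrier → Y.Carrier) (from : Y.Carrier → X.Carrier) →
              (∀ {x x′} → x X.≈ x′ → to x Y.≈ to x′) → (∀ {y y′} → y Y.≈ y′ → from y X.≈ from y′) →
              (∀ y → to (from y) Y.≈ y) → (∀ x → from (to x) X.≈ x) → Inverse X Y
  mkInverse to from to-cong from-cong to∘from from∘to = record
    { to        = to
    ; from      = from
    ; to-cong   = to-cong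
    ; from-cong = from-cong
    ; inverse   = (λ eq → Y.trans (to-cong eq) (to∘from _)) , (λ eq → X.trans (from-cong eq) (from∘to _))
    }

-- Regularity asks for an explicit size shared by group and code; decidable membership provides it
-- for the code.
subset-size : {P : Pred (F^ n) 0ℓ} → Decidable P → ∃[ m ] HasSize (SubsetSetoid P) m
subset-size {zero} P? with P? []
... | yes p = 1 , mkInverse (λ _ → zero) (λ _ → [] , p) (λ _ → refl) (λ _ → refl) (λ { zero → refl }) (λ { ([] , _) → refl })
... | no ¬p = 0 , mkInverse (λ { ([] , p) → contradiction p ¬p }) (λ ()) (λ { {[] , p} → contradiction p ¬p }) (λ { {()} })
                            (λ ()) (λ { ([] , p) → contradiction p ¬p })
subset-size {suc n} {P} P?
  with m₀ , size₀ ← subset-size (P? ∘ (false ∷_))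
  with m₁ , size₁ ← subset-size (P? ∘ (true ∷_)) = m₀ + m₁ , mkInverse to from to-cong from-cong to∘from from∘to
  where
  module I₀ = Inverse size₀
  module I₁ = Inverse size₁

  to : ∃ P → Fin (m₀ + m₁)
  to (false ∷ x , p) = I₀.to (x , p) ↑ˡ m₁
  to (true ∷ x , p)  = m₀ ↑ʳ I₁.to (x , p)

  from′ : Fin m₀ ⊎ Fin m₁ → ∃ P
  from′ (inj₁ i) = let x , p = I₀.from i in false ∷ x , p
  from′ (inj₂ j) = let x , p = I₁.from j in true ∷ x , p

  from : Fin (m₀ + m₁) → ∃ P
  from = from′ ∘ Fin.splitAt m₀

  to-cong : ∀ {x y} → proj₁ x ≡ proj₁ y → to x ≡ to y
  to-cong {false ∷ x , p} {_ , q} refl = cong (_↑ˡ m₁) (I₀.to-cong refl)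
  to-cong {true ∷ x , p}  {_ , q} refl = cong (m₀ ↑ʳ_) (I₁.to-cong refl)

  from-cong : ∀ {i j} → i ≡ j → proj₁ (from i) ≡ proj₁ (from j)
  from-cong refl = refl

  to∘from : ∀ i → to (from i) ≡ i
  to∘from = ↑-cases _
    (λ i → trans (cong (to ∘ from′) (splitAt-↑ˡ m₀ i m₁)) (cong (_↑ˡ m₁) (I₀.strictlyInverseˡ i)))
    (λ j → trans (cong (to ∘ from′) (splitAt-↑ʳ m₀ m₁ j)) (cong (m₀ ↑ʳ_) (I₁.strictlyInverseˡ j)))

  from∘to : ∀ x → proj₁ (from (to x)) ≡ proj₁ x
  from∘to (false ∷ x , p) =
    trans (cong (proj₁ ∘ from′) (splitAt-↑ˡ m₀ _ m₁)) (cong (false ∷_) (I₀.strictlyInverseʳ (x , p)))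
  from∘to (true ∷ x , p)  =
    trans (cong (proj₁ ∘ from′) (splitAt-↑ʳ m₀ m₁ _)) (cong (true ∷_) (I₁.strictlyInverseʳ (x , p)))

-- A missed `y` could be punched out, leaving an injection of `Fin (suc n)` into `Fin n`.
injective⇒surjective : {f : Fin n → Fin n} → Injective _≡_ _≡_ f → ∀ y → ∃[ x ] f x ≡ y
injective⇒surjective {suc n} {f} f-inj y with any? (λ x → f x Fin.≟ y)
... | yes p = p
... | no ∄  = contradiction (injective⇒≤ {f = λ x → punchOut (y≢ x)} (f-inj ∘ punchOut-injective (y≢ _) (y≢ _))) ℕ.1+n≰n
  where
  y≢ : ∀ x → y ≢ f x
  y≢ x eq = ∄ (x , sym eq)

-- Propelinear codes

-- The hypotheses say that `z ⊕ permute (π z) w` is a group law on `C`, with identity `𝟎`; the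
-- transformations (z, π z) are its left translations.
module _ {C : Code n} (C? : Decidable C) (π : F^ n → Permutation′ n)
         (𝟎∈ : C 𝟎) (π-𝟎 : π 𝟎 Perm.≈ Perm.id)
         (closed : ∀ {z w} → C z → C w → C (z ⊕ permute (π z) w))
         (π-⋆ : ∀ {z w} → C z → C w → π (z ⊕ permute (π z) w) Perm.≈ π w ∘ₚ π z)
         (inverse : ∀ {z} → C z → ∃[ w ] C w × z ⊕ permute (π z) w ≡ 𝟎)
  where
  private
    module G = Group (AutF n)
    module act = Action (autFAction n)

    φ : F^ n → G.Carrier
    φ z = z , π z

    φ-∙ : ∀ {z w} → C z → C w → φ z G.∙ φ w G.≈ φ (z ⊕ permute (π z) w)
    φ-∙ z∈ w∈ = refl , λ i → sym (π-⋆ z∈ w∈ i)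

    φ-inverse : ∀ {z} → C z → ∃[ w ] C w × φ z G.∙ φ w G.≈ G.ε
    φ-inverse {z} z∈ = let w , w∈ , eq = inverse z∈ in
      w , w∈ , G.trans {φ z G.∙ φ w} {φ (z ⊕ permute (π z) w)} {G.ε} (φ-∙ z∈ w∈) (eq , λ i → trans (cong (λ u → π u ⟨$⟩ʳ i) eq) (π-𝟎 i))

    φ-image : ∀ {z} → C z → image (autFAction n) (φ z) C ≐ C
    φ-image {z} z∈ = (λ { (w , w∈ , refl) → closed z∈ w∈ }) , λ {y} y∈ →
      let w , w∈ , eq = φ-inverse z∈ in
      w ⊕ permute (π w) y , closed w∈ y∈ ,
      trans (sym (act.compat (φ z) (φ w) y)) (trans (act.▷-cong {φ z G.∙ φ w} {G.ε} {y} eq refl) (act.identity y))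

    Γ : Subgroup (Subgroup.group (Aut C))
    Γ = record
      -- Permutations are compared pointwise, so membership is stated up to `G.≈`.
      { member    = λ (g , _) → ∃[ z ] C z × g G.≈ φ z
      ; resp-≈    = λ {(g , _)} {(h , _)} g≈h (z , z∈ , eq) →
          z , z∈ , G.trans {h} {g} {φ z} (G.sym {g} {h} g≈h) eq
      ; ε-closed  = 𝟎 , 𝟎∈ , refl , λ i → sym (π-𝟎 i)
      ; ∙-closed  = λ {(g , _)} {(h , _)} (z , z∈ , p) (w , w∈ , q) →
          z ⊕ permute (π z) w , closed z∈ w∈ ,
          G.trans {g G.∙ h} {φ z G.∙ φ w} {φ (z ⊕ permute (π z) w)} (G.∙-cong {g} {φ z} {h} {φ w} p q) (φ-∙ z∈ w∈)
      ; ⁻¹-closed = λ {(g , _)} (z , z∈ , p) → let w , w∈ , q = φ-inverse z∈ in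
          w , w∈ , G.sym {φ w} {g G.⁻¹} (GroupProperties.inverseʳ-unique (AutF n) g (φ w)
            (G.trans {g G.∙ φ w} {φ z G.∙ φ w} {G.ε} (G.∙-cong {g} {φ z} {φ w} {φ w} p (G.refl {φ w})) q))
      }

    module Γ = Group (Subgroup.group Γ)

    translation : ∃ C → Γ.Carrier
    translation (z , z∈) = (φ z , φ-image z∈) , z , z∈ , G.refl {φ z}

    -- An element is determined by its translation part, the image of `𝟎`.
    Γ↔C : Inverse Γ.setoid (SubsetSetoid C)
    Γ↔C = mkInverse
      (λ (_ , z , z∈ , _) → z , z∈)
      translation
      (λ { {(_ , _ , _ , p , _)} {(_ , _ , _ , q , _)} (eq , _) → trans (sym p) (trans eq q) })
      (λ { refl → G.refl {φ _} })
      (λ _ → refl)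
      (λ ((g , _) , z , _ , p) → G.sym {g} {φ z} p)

  propelinear : Propelinear C
  propelinear = Γ , record
    { transitive = λ (x , x∈) (y , y∈) →
        -- The inverse of the translation by `x` takes `x` to `𝟎`, and the translation by `y` takes
        -- `𝟎` to `y`.
        translation (y , y∈) Γ.∙ translation (x , x∈) Γ.⁻¹ ,
        trans (act.compat (φ y) (φ x G.⁻¹) x)
          (trans (cong (φ y act.▷_) (⊕-same (permute (Perm.flip (π x)) x))) (trans (cong (y ⊕_) (permute-𝟎 (π y))) (⊕-identityʳ y)))
    ; order≡size = let s , size = subset-size C? in s , Inverse-∘ Γ↔C size , size
    }

-- Permutations acting blockwise

_⊎ₚ_ : Permutation′ m → Permutation′ n → Permutation′ (m + n)
π ⊎ₚ ρ = ↔-sym +↔⊎ ↔-∘ ((π ⊎-↔ ρ) ↔-∘ +↔⊎)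

module _ (π : Permutation′ m) (ρ : Permutation′ n) where

  ⊎ₚ-↑ˡ : ∀ i → (π ⊎ₚ ρ) ⟨$⟩ʳ (i ↑ˡ n) ≡ (π ⟨$⟩ʳ i) ↑ˡ n
  ⊎ₚ-↑ˡ i rewrite splitAt-↑ˡ m i n = refl

  ⊎ₚ-↑ʳ : ∀ j → (π ⊎ₚ ρ) ⟨$⟩ʳ (m ↑ʳ j) ≡ m ↑ʳ (ρ ⟨$⟩ʳ j)
  ⊎ₚ-↑ʳ j rewrite splitAt-↑ʳ m n j = refl

  permute-⊎ₚ : ∀ z → permute (π ⊎ₚ ρ) z ≡ permute π (take m z) ++ permute ρ (drop m z)
  permute-⊎ₚ = additive-ext (permute-⊕ (π ⊎ₚ ρ))
    (++-additive (∘-additive (permute-⊕ π) (take-⊕ m)) (∘-additive (permute-⊕ ρ) (drop-⊕ m)))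
    (↑-cases _
      (λ i → begin
        permute (π ⊎ₚ ρ) (unit (i ↑ˡ n))    ≡⟨ permute-unit (π ⊎ₚ ρ) (i ↑ˡ n) ⟩
        unit ((π ⊎ₚ ρ) ⟨$⟩ʳ (i ↑ˡ n))       ≡⟨ cong unit (⊎ₚ-↑ˡ i) ⟩
        unit ((π ⟨$⟩ʳ i) ↑ˡ n)              ≡⟨ unit-↑ˡ (π ⟨$⟩ʳ i) ⟩
        unit (π ⟨$⟩ʳ i) ++ 𝟎                ≡⟨ cong₂ _++_ (permute-unit π i) (permute-𝟎 ρ) ⟨
        permute π (unit i) ++ permute ρ 𝟎   ≡⟨ blocks (unit i) 𝟎 (unit-↑ˡ i) ⟨
        blockwise (unit (i ↑ˡ n))           ∎)
      (λ j → begin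
        permute (π ⊎ₚ ρ) (unit (m ↑ʳ j))    ≡⟨ permute-unit (π ⊎ₚ ρ) (m ↑ʳ j) ⟩
        unit ((π ⊎ₚ ρ) ⟨$⟩ʳ (m ↑ʳ j))       ≡⟨ cong unit (⊎ₚ-↑ʳ j) ⟩
        unit (m ↑ʳ (ρ ⟨$⟩ʳ j))              ≡⟨ unit-↑ʳ m (ρ ⟨$⟩ʳ j) ⟩
        𝟎 ++ unit (ρ ⟨$⟩ʳ j)                ≡⟨ cong₂ _++_ (permute-𝟎 π) (permute-unit ρ j) ⟨
        permute π 𝟎 ++ permute ρ (unit j)   ≡⟨ blocks 𝟎 (unit j) (unit-↑ʳ m j) ⟨
        blockwise (unit (m ↑ʳ j))           ∎))
    where
    open ≡-Reasoning
    blockwise : F^ (m + n) → F^ (m + n)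
    blockwise z = permute π (take m z) ++ permute ρ (drop m z)

    blocks : ∀ {z} x y → z ≡ x ++ y → blockwise z ≡ permute π x ++ permute ρ y
    blocks x y refl = cong₂ (λ x y → permute π x ++ permute ρ y) (take-++ x y) (drop-++ x y)

⊎ₚ-id : {π : Permutation′ m} {ρ : Permutation′ n} → π Perm.≈ Perm.id → ρ Perm.≈ Perm.id → (π ⊎ₚ ρ) Perm.≈ Perm.id
⊎ₚ-id {π = π} {ρ} π≈ ρ≈ = ↑-cases _
  (λ i → trans (⊎ₚ-↑ˡ π ρ i) (cong (_↑ˡ _) (π≈ i)))
  (λ j → trans (⊎ₚ-↑ʳ π ρ j) (cong (_ ↑ʳ_) (ρ≈ j)))

⊎ₚ-∘ : {π π₁ π₂ : Permutation′ m} {ρ ρ₁ ρ₂ : Permutation′ n} → π Perm.≈ π₁ ∘ₚ π₂ → ρ Perm.≈ ρ₁ ∘ₚ ρ₂ →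
       (π ⊎ₚ ρ) Perm.≈ (π₁ ⊎ₚ ρ₁) ∘ₚ (π₂ ⊎ₚ ρ₂)
⊎ₚ-∘ {m} {n} {π} {π₁} {π₂} {ρ} {ρ₁} {ρ₂} π≈ ρ≈ = ↑-cases _
  (λ i → begin
    (π ⊎ₚ ρ) ⟨$⟩ʳ (i ↑ˡ n)                                ≡⟨ ⊎ₚ-↑ˡ π ρ i ⟩
    (π ⟨$⟩ʳ i) ↑ˡ n                                       ≡⟨ cong (_↑ˡ n) (π≈ i) ⟩
    (π₂ ⟨$⟩ʳ (π₁ ⟨$⟩ʳ i)) ↑ˡ n                            ≡⟨ ⊎ₚ-↑ˡ π₂ ρ₂ (π₁ ⟨$⟩ʳ i) ⟨
    (π₂ ⊎ₚ ρ₂) ⟨$⟩ʳ ((π₁ ⟨$⟩ʳ i) ↑ˡ n)                    ≡⟨ cong ((π₂ ⊎ₚ ρ₂) ⟨$⟩ʳ_) (⊎ₚ-↑ˡ π₁ ρ₁ i) ⟨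
    (π₂ ⊎ₚ ρ₂) ⟨$⟩ʳ ((π₁ ⊎ₚ ρ₁) ⟨$⟩ʳ (i ↑ˡ n))            ∎)
  (λ j → begin
    (π ⊎ₚ ρ) ⟨$⟩ʳ (m ↑ʳ j)                                ≡⟨ ⊎ₚ-↑ʳ π ρ j ⟩
    m ↑ʳ (ρ ⟨$⟩ʳ j)                                       ≡⟨ cong (m ↑ʳ_) (ρ≈ j) ⟩
    m ↑ʳ (ρ₂ ⟨$⟩ʳ (ρ₁ ⟨$⟩ʳ j))                            ≡⟨ ⊎ₚ-↑ʳ π₂ ρ₂ (ρ₁ ⟨$⟩ʳ j) ⟨
    (π₂ ⊎ₚ ρ₂) ⟨$⟩ʳ (m ↑ʳ (ρ₁ ⟨$⟩ʳ j))                    ≡⟨ cong ((π₂ ⊎ₚ ρ₂) ⟨$⟩ʳ_) (⊎ₚ-↑ʳ π₁ ρ₁ j) ⟨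
    (π₂ ⊎ₚ ρ₂) ⟨$⟩ʳ ((π₁ ⊎ₚ ρ₁) ⟨$⟩ʳ (m ↑ʳ j))            ∎)
  where open ≡-Reasoning

-- The multiplication a ∘ b = a ⊕ L a b is that of the regular group formed by
-- the affine maps x ↦ a ⊕ L a x, transported to F^ r by evaluation at 𝟎, and ρ
-- is an automorphism of it.
record RegularAffine (ρ : F^ r ↔ F^ r) : Set where
  open Inverse ρ using () renaming (to to f)
  field
    linear : F^ r → F^ r ↔ F^ r

  L : F^ r → F^ r → F^ r
  L a = Inverse.to (linear a)

  field
    L-⊕   : ∀ a → Additive (L a)
    L-𝟎   : ∀ x → L 𝟎 x ≡ x
    L-∘   : ∀ a b x → L (a ⊕ L a b) x ≡ L a (L b x)
    ρ-hom : ∀ a b → f (a ⊕ L a b) ≡ f a ⊕ L (f a) (f b)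

  L-injective : ∀ a {x y} → L a x ≡ L a y → x ≡ y
  L-injective a {x} {y} eq = trans (sym (Inverse.strictlyInverseʳ (linear a) x))
    (trans (cong (Inverse.from (linear a)) eq) (Inverse.strictlyInverseʳ (linear a) y))

  -- `f 𝟎` is idempotent for the group law, which gives `L (f 𝟎) (f 𝟎) ≡ 𝟎`; injectivity of
  -- `L (f 𝟎)` finishes.
  ρ-𝟎 : f 𝟎 ≡ 𝟎
  ρ-𝟎 = L-injective (f 𝟎) (trans (trans (⊕-transpose (sym f𝟎≡)) (⊕-same (f 𝟎))) (sym (additive-𝟎 (L-⊕ (f 𝟎)))))
    where
    f𝟎≡ : f 𝟎 ≡ f 𝟎 ⊕ L (f 𝟎) (f 𝟎)
    f𝟎≡ = trans (cong f (sym (trans (⊕-identityˡ (L 𝟎 𝟎)) (L-𝟎 𝟎)))) (ρ-hom 𝟎 𝟎)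

  private
    N = 2 ^ r

    P : F^ r → Permutation′ N
    P a = coordinatePermutation (linear a)

    sˡ sʳ : F^ (N + N) → F^ r
    sˡ z = syndrome r (take N z)
    sʳ z = syndrome r (drop N z)

    -- On codewords `sʳ z` equals ρ(`sˡ z`). Indexing the right block by `sʳ z` makes `π-⋆` hold for
    -- all vectors.
    π : F^ (N + N) → Permutation′ (N + N)
    π z = P (sˡ z) ⊎ₚ P (sʳ z)

    Sℋ′ : Pred (F^ (N + N)) 0ℓ
    Sℋ′ z = parity (take N z) ≡ false × parity (drop N z) ≡ false × f (sˡ z) ≡ sʳ z

    Sℋ⇔Sℋ′ : ∀ {z} → Sℋ ρ z ⇔ Sℋ′ z
    Sℋ⇔Sℋ′ = Sℋ⇔ ρ refl

    P-𝟎 : P 𝟎 Perm.≈ Perm.id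
    P-𝟎 i = trans (cong index (L-𝟎 (vector r i))) (index-vector {r} i)

    P-∘ : ∀ a b → P (a ⊕ L a b) Perm.≈ P b ∘ₚ P a
    P-∘ a b i = cong index (trans (L-∘ a b (vector r i)) (cong (L a) (sym (vector-index (L b (vector r i))))))

    syndrome-P : ∀ a x → syndrome r (permute (P a) x) ≡ L a (syndrome r x)
    syndrome-P a = syndrome-permute (linear a) (L-⊕ a)

    permute-π : ∀ z w → permute (π z) w ≡ permute (P (sˡ z)) (take N w) ++ permute (P (sʳ z)) (drop N w)
    permute-π z = permute-⊎ₚ (P (sˡ z)) (P (sʳ z))

    take-⋆ : ∀ z w → take N (z ⊕ permute (π z) w) ≡ take N z ⊕ permute (P (sˡ z)) (take N w)
    take-⋆ z w = trans (take-⊕ N z (permute (π z) w))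
      (cong (take N z ⊕_) (trans (cong (take N) (permute-π z w)) (take-++ _ (permute (P (sʳ z)) (drop N w)))))

    drop-⋆ : ∀ z w → drop N (z ⊕ permute (π z) w) ≡ drop N z ⊕ permute (P (sʳ z)) (drop N w)
    drop-⋆ z w = trans (drop-⊕ N z (permute (π z) w))
      (cong (drop N z ⊕_) (trans (cong (drop N) (permute-π z w)) (drop-++ (permute (P (sˡ z)) (take N w)) _)))

    sˡ-⋆ : ∀ z w → sˡ (z ⊕ permute (π z) w) ≡ sˡ z ⊕ L (sˡ z) (sˡ w)
    sˡ-⋆ z w = trans (cong (syndrome r) (take-⋆ z w))
      (trans (syndrome-⊕ r _ _) (cong (sˡ z ⊕_) (syndrome-P (sˡ z) (take N w))))

    sʳ-⋆ : ∀ z w → sʳ (z ⊕ permute (π z) w) ≡ sʳ z ⊕ L (sʳ z) (sʳ w)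
    sʳ-⋆ z w = trans (cong (syndrome r) (drop-⋆ z w))
      (trans (syndrome-⊕ r _ _) (cong (sʳ z ⊕_) (syndrome-P (sʳ z) (drop N w))))

    parity-shift : ∀ a (x y : F^ N) → parity x ≡ false → parity y ≡ false → parity (x ⊕ permute (P a) y) ≡ false
    parity-shift a x y p q = trans (parity-⊕ x (permute (P a) y)) (cong₂ _xor_ p (trans (parity-permute (P a) y) q))

    Sℋ′-closed : ∀ {z w} → Sℋ′ z → Sℋ′ w → Sℋ′ (z ⊕ permute (π z) w)
    Sℋ′-closed {z} {w} (p , q , s) (p′ , q′ , s′) =
      trans (cong parity (take-⋆ z w)) (parity-shift (sˡ z) (take N z) (take N w) p p′) ,
      trans (cong parity (drop-⋆ z w)) (parity-shift (sʳ z) (drop N z) (drop N w) q q′) ,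
      (begin
        f (sˡ (z ⊕ permute (π z) w))        ≡⟨ cong f (sˡ-⋆ z w) ⟩
        f (sˡ z ⊕ L (sˡ z) (sˡ w))          ≡⟨ ρ-hom (sˡ z) (sˡ w) ⟩
        f (sˡ z) ⊕ L (f (sˡ z)) (f (sˡ w))  ≡⟨ cong₂ (λ a b → a ⊕ L a b) s s′ ⟩
        sʳ z ⊕ L (sʳ z) (sʳ w)              ≡⟨ sʳ-⋆ z w ⟨
        sʳ (z ⊕ permute (π z) w)            ∎)
      where open ≡-Reasoning

    π-⋆ : ∀ z w → π (z ⊕ permute (π z) w) Perm.≈ π w ∘ₚ π z
    π-⋆ z w = ⊎ₚ-∘
      {π = P (sˡ (z ⊕ permute (π z) w))} {P (sˡ w)} {P (sˡ z)} {P (sʳ (z ⊕ permute (π z) w))} {P (sʳ w)} {P (sʳ z)}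
      (λ i → trans (cong (λ a → P a ⟨$⟩ʳ i) (sˡ-⋆ z w)) (P-∘ (sˡ z) (sˡ w) i))
      (λ i → trans (cong (λ a → P a ⟨$⟩ʳ i) (sʳ-⋆ z w)) (P-∘ (sʳ z) (sʳ w) i))

    -- The witness is `z` with each half permuted back, so `permute (π z) w` is `z` and the sum
    -- vanishes.
    Sℋ′-inverse : ∀ {z} → Sℋ′ z → ∃[ w ] Sℋ′ w × z ⊕ permute (π z) w ≡ 𝟎
    Sℋ′-inverse {z} (p , q , s) = w , (w-evenˡ , w-evenʳ , w-graph) , (begin
      z ⊕ permute (π z) w                                   ≡⟨ cong (z ⊕_) (permute-π z w) ⟩
      z ⊕ (permute Pˡ (take N w) ++ permute Pʳ (drop N w))  ≡⟨ cong (z ⊕_) (cong₂ _++_ permute-take permute-drop) ⟩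
      z ⊕ (take N z ++ drop N z)                            ≡⟨ cong (z ⊕_) (take++drop≡id N z) ⟩
      z ⊕ z                                                 ≡⟨ ⊕-same z ⟩
      𝟎                                                     ∎)
      where
      open ≡-Reasoning
      Pˡ = P (sˡ z)
      Pʳ = P (sʳ z)
      u  = permute (Perm.flip Pˡ) (take N z)
      v  = permute (Perm.flip Pʳ) (drop N z)
      w  = u ++ v

      permute-take : permute Pˡ (take N w) ≡ take N z
      permute-take = trans (cong (permute Pˡ) (take-++ u v)) (permute-flip Pˡ (take N z))

      permute-drop : permute Pʳ (drop N w) ≡ drop N z
      permute-drop = trans (cong (permute Pʳ) (drop-++ u v)) (permute-flip Pʳ (drop N z))

      w-evenˡ : parity (take N w) ≡ false
      w-evenˡ = trans (sym (parity-permute Pˡ (take N w))) (trans (cong parity permute-take) p)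

      w-evenʳ : parity (drop N w) ≡ false
      w-evenʳ = trans (sym (parity-permute Pʳ (drop N w))) (trans (cong parity permute-drop) q)

      L-sˡ : L (sˡ z) (sˡ w) ≡ sˡ z
      L-sˡ = trans (sym (syndrome-P (sˡ z) (take N w))) (cong (syndrome r) permute-take)

      L-sʳ : L (sʳ z) (sʳ w) ≡ sʳ z
      L-sʳ = trans (sym (syndrome-P (sʳ z) (drop N w))) (cong (syndrome r) permute-drop)

      -- `sˡ w` and `sʳ w` are the inverses of `sˡ z` and `sʳ z` in the group law, and the
      -- homomorphism ρ preserves inverses.
      w-graph : f (sˡ w) ≡ sʳ w
      w-graph = L-injective (sʳ z) (begin
        L (sʳ z) (f (sˡ w))                   ≡⟨ cong (λ a → L a (f (sˡ w))) s ⟨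
        L (f (sˡ z)) (f (sˡ w))               ≡⟨ ⊕-transpose (sym (ρ-hom (sˡ z) (sˡ w))) ⟩
        f (sˡ z) ⊕ f (sˡ z ⊕ L (sˡ z) (sˡ w)) ≡⟨ cong (λ a → f (sˡ z) ⊕ f (sˡ z ⊕ a)) L-sˡ ⟩
        f (sˡ z) ⊕ f (sˡ z ⊕ sˡ z)            ≡⟨ cong (λ a → f (sˡ z) ⊕ f a) (⊕-same (sˡ z)) ⟩
        f (sˡ z) ⊕ f 𝟎                        ≡⟨ cong₂ _⊕_ s ρ-𝟎 ⟩
        sʳ z ⊕ 𝟎                              ≡⟨ ⊕-identityʳ (sʳ z) ⟩
        sʳ z                                  ≡⟨ L-sʳ ⟨
        L (sʳ z) (sʳ w)                       ∎)

    Sℋ? : Decidable (Sℋ ρ)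
    Sℋ? z = map′ (Equivalence.from Sℋ⇔Sℋ′) (Equivalence.to Sℋ⇔Sℋ′)
      ((parity (take N z) Bool.≟ false) ×-dec (parity (drop N z) Bool.≟ false) ×-dec (f (sˡ z) ≟ sʳ z))

    sˡ-𝟎 : sˡ 𝟎 ≡ 𝟎
    sˡ-𝟎 = additive-𝟎 (∘-additive (syndrome-⊕ r) (take-⊕ N))

    sʳ-𝟎 : sʳ 𝟎 ≡ 𝟎
    sʳ-𝟎 = additive-𝟎 (∘-additive (syndrome-⊕ r) (drop-⊕ N))

    𝟎∈Sℋ′ : Sℋ′ 𝟎
    𝟎∈Sℋ′ = trans (cong parity (additive-𝟎 (take-⊕ N))) (parity-𝟎 {N}) ,
             trans (cong parity (additive-𝟎 (drop-⊕ N))) (parity-𝟎 {N}) ,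
             trans (cong f sˡ-𝟎) (trans ρ-𝟎 (sym sʳ-𝟎))

  Sℋ-propelinear : Propelinear (Sℋ ρ)
  Sℋ-propelinear = propelinear Sℋ? π (from 𝟎∈Sℋ′)
    (⊎ₚ-id {π = P (sˡ 𝟎)} {P (sʳ 𝟎)}
      (λ i → trans (cong (λ a → P a ⟨$⟩ʳ i) sˡ-𝟎) (P-𝟎 i))
      (λ i → trans (cong (λ a → P a ⟨$⟩ʳ i) sʳ-𝟎) (P-𝟎 i)))
    (λ {z} {w} z∈ w∈ → from (Sℋ′-closed {z} {w} (to z∈) (to w∈)))
    (λ {z} {w} _ _ → π-⋆ z w)
    (λ z∈ → let w , w∈ , eq = Sℋ′-inverse (to z∈) in w , from w∈ , eq)
    where
    to : ∀ {z} → Sℋ ρ z → Sℋ′ z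
    to {z} = Equivalence.to (Sℋ⇔Sℋ′ {z})
    from : ∀ {z} → Sℋ′ z → Sℋ ρ z
    from {z} = Equivalence.from (Sℋ⇔Sℋ′ {z})

-- This is the direct product of the two groups acting blockwise, with the product automorphism.
∥-regularAffine : {τ : F^ r₁ ↔ F^ r₁} {σ : F^ r₂ ↔ F^ r₂} → RegularAffine τ → RegularAffine σ → RegularAffine (τ ∥ σ)
∥-regularAffine {r₁} {r₂} {τ} {σ} A B = record
  { linear = linear
  ; L-⊕    = λ a x y → trans
      (cong₂ _++_ (trans (cong (A.L (take r₁ a)) (take-⊕ r₁ x y)) (A.L-⊕ (take r₁ a) (take r₁ x) (take r₁ y)))
                  (trans (cong (B.L (drop r₁ a)) (drop-⊕ r₁ x y)) (B.L-⊕ (drop r₁ a) (drop r₁ x) (drop r₁ y))))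
      (++-⊕ (A.L (take r₁ a) (take r₁ x)) (A.L (take r₁ a) (take r₁ y)) (B.L (drop r₁ a) (drop r₁ x)) (B.L (drop r₁ a) (drop r₁ y)))
  ; L-𝟎    = λ x → trans
      (cong₂ _++_ (trans (cong (λ a → A.L a (take r₁ x)) (additive-𝟎 (take-⊕ r₁))) (A.L-𝟎 (take r₁ x)))
                  (trans (cong (λ a → B.L a (drop r₁ x)) (additive-𝟎 (drop-⊕ r₁))) (B.L-𝟎 (drop r₁ x))))
      (take++drop≡id r₁ x)
  ; L-∘    = λ a b x → cong₂ _++_
      (trans (cong (λ c → A.L c (take r₁ x)) (take-∘ a b))
        (trans (A.L-∘ (take r₁ a) (take r₁ b) (take r₁ x)) (cong (A.L (take r₁ a)) (sym (take-++ _ (B.L (drop r₁ b) (drop r₁ x)))))))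
      (trans (cong (λ c → B.L c (drop r₁ x)) (drop-∘ a b))
        (trans (B.L-∘ (drop r₁ a) (drop r₁ b) (drop r₁ x)) (cong (B.L (drop r₁ a)) (sym (drop-++ (A.L (take r₁ b) (take r₁ x)) _)))))
  ; ρ-hom  = λ a b → trans
      (cong₂ _++_ (trans (cong τ.to (take-∘ a b)) (A.ρ-hom (take r₁ a) (take r₁ b)))
                  (trans (cong σ.to (drop-∘ a b)) (B.ρ-hom (drop r₁ a) (drop r₁ b))))
      (trans (++-⊕ (τ.to (take r₁ a)) (A.L (τ.to (take r₁ a)) (τ.to (take r₁ b)))
                   (σ.to (drop r₁ a)) (B.L (σ.to (drop r₁ a)) (σ.to (drop r₁ b))))
        (cong (ρ.to a ⊕_) (cong₂ _++_
          (sym (cong₂ A.L (take-ρ a) (take-ρ b)))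
          (sym (cong₂ B.L (drop-ρ a) (drop-ρ b))))))
  }
  where
  module A = RegularAffine A
  module B = RegularAffine B
  module τ = Inverse τ
  module σ = Inverse σ
  module ρ = Inverse (τ ∥ σ)

  linear : F^ (r₁ + r₂) → F^ (r₁ + r₂) ↔ F^ (r₁ + r₂)
  linear a = A.linear (take r₁ a) ∥ B.linear (drop r₁ a)

  L : F^ (r₁ + r₂) → F^ (r₁ + r₂) → F^ (r₁ + r₂)
  L a = Inverse.to (linear a)

  take-∘ : ∀ a b → take r₁ (a ⊕ L a b) ≡ take r₁ a ⊕ A.L (take r₁ a) (take r₁ b)
  take-∘ a b = trans (take-⊕ r₁ a (L a b)) (cong (take r₁ a ⊕_) (take-++ _ (B.L (drop r₁ a) (drop r₁ b))))

  drop-∘ : ∀ a b → drop r₁ (a ⊕ L a b) ≡ drop r₁ a ⊕ B.L (drop r₁ a) (drop r₁ b)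
  drop-∘ a b = trans (drop-⊕ r₁ a (L a b)) (cong (drop r₁ a ⊕_) (drop-++ (A.L (take r₁ a) (take r₁ b)) _))

  take-ρ : ∀ a → take r₁ (ρ.to a) ≡ τ.to (take r₁ a)
  take-ρ a = take-++ _ (σ.to (drop r₁ a))

  drop-ρ : ∀ a → drop r₁ (ρ.to a) ≡ σ.to (drop r₁ a)
  drop-ρ a = drop-++ (τ.to (take r₁ a)) _

-- Regular subgroups of the affine group and induced permutations

matrixBijection : GL r → F^ r ↔ F^ r
matrixBijection M = mk↔ₛ′ (M.matrix ·_) (M.inverse ·_) (cancel M.matrix M.inverse M.inverseʳ) (cancel M.inverse M.matrix M.inverseˡ)
  where
  module M = GL M
  cancel : (A B : Matrix r) → A ⊗ B ≡ I → ∀ x → A · B · x ≡ x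
  cancel A B eq x = trans (sym (map-·-· A B x)) (trans (cong (_· x) eq) (I-· x))

module _ (G : Subgroup (GA r)) (reg : RegularSubgroup G) where
  private
    module G = Group (Subgroup.group G)
    module act = Action (restrict (affineAction r) G)

    g : F^ r → G.Carrier
    g = element G reg

    g-▷𝟎 : ∀ a → g a act.▷ 𝟎 ≡ a
    g-▷𝟎 a = proj₂ (Regular.transitive reg 𝟎 a)

    matrix : G.Carrier → Matrix r
    matrix ((_ , M) , _) = GL.matrix M

    ▷𝟎 : ∀ h → h act.▷ 𝟎 ≡ proj₁ (proj₁ h)
    ▷𝟎 h = trans (cong (proj₁ (proj₁ h) ⊕_) (·-zero (matrix h))) (⊕-identityʳ _)

    g-▷ : ∀ a x → g a act.▷ x ≡ a ⊕ matrix (g a) · x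
    g-▷ a x = cong (_⊕ matrix (g a) · x) (trans (sym (▷𝟎 (g a))) (g-▷𝟎 a))

  -- A section of the evaluation at 𝟎 is an injection between finite sets of
  -- the same size, hence onto.
  element-unique : ∀ h → h G.≈ g (h act.▷ 𝟎)
  element-unique h = G.trans {h} {g a} {g (h act.▷ 𝟎)} h≈ga
    (Group.reflexive (Subgroup.group G) (cong g (trans (sym (g-▷𝟎 a)) (act.▷-cong {g a} {h} (G.sym {h} {g a} h≈ga) refl))))
    where
    size = Regular.order≡size reg
    module SG = Inverse (proj₁ (proj₂ size))
    module SF = Inverse (proj₂ (proj₂ size))

    s : Fin (proj₁ size) → Fin (proj₁ size)
    s = SG.to ∘ g ∘ SF.from

    s-injective : Injective _≡_ _≡_ s
    s-injective {i} {j} eq =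
      trans (sym (SF.strictlyInverseˡ i)) (trans (cong SF.to from-i≡from-j) (SF.strictlyInverseˡ j))
      where
      gi = g (SF.from i)
      gj = g (SF.from j)

      gi≈gj : gi G.≈ gj
      gi≈gj = G.trans {gi} {SG.from (SG.to gi)} {gj} (G.sym {SG.from (SG.to gi)} {gi} (SG.strictlyInverseʳ gi))
        (G.trans {SG.from (SG.to gi)} {SG.from (SG.to gj)} {gj} (SG.from-cong eq) (SG.strictlyInverseʳ gj))

      from-i≡from-j : SF.from i ≡ SF.from j
      from-i≡from-j = trans (sym (g-▷𝟎 _)) (trans (act.▷-cong {gi} {gj} gi≈gj refl) (g-▷𝟎 _))

    j = proj₁ (injective⇒surjective s-injective (SG.to h))
    a = SF.from j

    h≈ga : h G.≈ g a
    h≈ga = G.trans {h} {SG.from (SG.to h)} {g a} (G.sym {SG.from (SG.to h)} {h} (SG.strictlyInverseʳ h))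
      (G.trans {SG.from (SG.to h)} {SG.from (SG.to (g a))} {g a}
        (SG.from-cong (sym (proj₂ (injective⇒surjective s-injective (SG.to h))))) (SG.strictlyInverseʳ (g a)))

  -- The product sends `𝟎` to g_a(b), and `element-unique` identifies elements by the image of `𝟎`.
  element-∙ : ∀ a b → g a G.∙ g b G.≈ g (a ⊕ matrix (g a) · b)
  element-∙ a b = G.trans {g a G.∙ g b} {g ((g a G.∙ g b) act.▷ 𝟎)} {g (a ⊕ matrix (g a) · b)} (element-unique (g a G.∙ g b))
    (Group.reflexive (Subgroup.group G) (cong g (trans (act.compat (g a) (g b) 𝟎)
      (trans (cong (g a act.▷_) (g-▷𝟎 b)) (g-▷ a b)))))

  induced-regularAffine : (T : Automorphism (Subgroup.group G)) (τ : F^ r ↔ F^ r) → Induces G reg T τ → RegularAffine τ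
  induced-regularAffine T τ induces = record
    { linear = λ a → matrixBijection (proj₂ (proj₁ (g a)))
    ; L-⊕    = λ a → ·-⊕ (matrix (g a))
    -- The identity of `G` fixes `𝟎`, hence it is `g 𝟎`, whose matrix is therefore `I`.
    ; L-𝟎    = λ x → trans (cong (_· x) (sym (trans (proj₂ (element-unique G.ε)) (cong (matrix ∘ g) ε▷𝟎)))) (I-· x)
    ; L-∘    = λ a b x → trans (cong (_· x) (sym (proj₂ (element-∙ a b)))) (map-·-· (matrix (g a)) (matrix (g b)) x)
    ; ρ-hom  = hom
    }
    where
    module T = Automorphism T
    module M = GroupMorphisms.IsGroupIsomorphism T.isGroupIsomorphism
    f = Inverse.to τ

    ε▷𝟎 : G.ε act.▷ 𝟎 ≡ 𝟎
    ε▷𝟎 = act.identity 𝟎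

    open import Relation.Binary.Reasoning.Setoid G.setoid

    hom-≈ : ∀ a b → g (f (a ⊕ matrix (g a) · b)) G.≈ g (f a ⊕ matrix (g (f a)) · f b)
    hom-≈ a b = begin
      g (f (a ⊕ matrix (g a) · b))        ≈⟨ induces (a ⊕ matrix (g a) · b) ⟨
      T.⟦ g (a ⊕ matrix (g a) · b) ⟧      ≈⟨ M.⟦⟧-cong {g a G.∙ g b} {g (a ⊕ matrix (g a) · b)} (element-∙ a b) ⟨
      T.⟦ g a G.∙ g b ⟧                   ≈⟨ M.∙-homo (g a) (g b) ⟩
      T.⟦ g a ⟧ G.∙ T.⟦ g b ⟧             ≈⟨ G.∙-cong {T.⟦ g a ⟧} {g (f a)} {T.⟦ g b ⟧} {g (f b)} (induces a) (induces b) ⟩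
      g (f a) G.∙ g (f b)                 ≈⟨ element-∙ (f a) (f b) ⟩
      g (f a ⊕ matrix (g (f a)) · f b)    ∎

    hom : ∀ a b → f (a ⊕ matrix (g a) · b) ≡ f a ⊕ matrix (g (f a)) · f b
    hom a b = trans (sym (g-▷𝟎 c)) (trans (act.▷-cong {g c} {g c′} (hom-≈ a b) refl) (g-▷𝟎 c′))
      where
      c  = f (a ⊕ matrix (g a) · b)
      c′ = f a ⊕ matrix (g (f a)) · f b

-- Counting dimensions

2^[r+1]≡2^r+2^r : ∀ r → 2 ^ (r + 1) ≡ 2 ^ r + 2 ^ r
2^[r+1]≡2^r+2^r r = trans (cong (2 ^_) (ℕ.+-comm r 1)) (cong (λ n → 2 ^ r + n) (ℕ.+-identityʳ (2 ^ r)))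

kernel-count : ∀ {N k₁ k₂} κ r₁ r₂ d₁ d₂ → κ + (2 + ((r₁ + r₂) + (r₁ + r₂))) ≡ N →
               k₁ ≡ + r₁ ℤ.- + d₁ → k₂ ≡ + r₂ ℤ.- + d₂ →
               + (κ + (d₁ + d₂)) ≡ + N ℤ.- + r₁ ℤ.- + r₂ ℤ.- + 2 ℤ.- k₁ ℤ.- k₂
kernel-count κ r₁ r₂ d₁ d₂ refl refl refl = sym (trans
  (cong (λ t → t ℤ.- (+ r₁ ℤ.- + d₁) ℤ.- (+ r₂ ℤ.- + d₂)) (cancel-2 (+ 2) (+ κ) (+ r₁) (+ r₂)))
  (cancel-r (+ κ) (+ r₁) (+ r₂) (+ d₁) (+ d₂)))
  where
  cancel-2 : ∀ t κ r₁ r₂ → κ ℤ.+ (t ℤ.+ ((r₁ ℤ.+ r₂) ℤ.+ (r₁ ℤ.+ r₂))) ℤ.- r₁ ℤ.- r₂ ℤ.- t ≡ κ ℤ.+ (r₁ ℤ.+ r₂)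
  cancel-2 = ℤ.solve-∀

  cancel-r : ∀ κ r₁ r₂ d₁ d₂ → κ ℤ.+ (r₁ ℤ.+ r₂) ℤ.- (r₁ ℤ.- d₁) ℤ.- (r₂ ℤ.- d₂) ≡ κ ℤ.+ (d₁ ℤ.+ d₂)
  cancel-r = ℤ.solve-∀

rank-count : ∀ {N P₁ P₂ l₁ l₂} κ r₁ r₂ d₁ d₂ w₁ w₂ → κ + (2 + ((r₁ + r₂) + (r₁ + r₂))) ≡ N →
             d₁ + 1 + w₁ ≡ P₁ → d₂ + 1 + w₂ ≡ P₂ →
             l₁ ≡ + P₁ ℤ.- + r₁ ℤ.- + 1 ℤ.- + d₁ → l₂ ≡ + P₂ ℤ.- + r₂ ℤ.- + 1 ℤ.- + d₂ →
             + (κ + (w₁ + w₂)) ≡ + N ℤ.- + r₁ ℤ.- + r₂ ℤ.- + 2 ℤ.+ l₁ ℤ.+ l₂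
rank-count {N} κ r₁ r₂ d₁ d₂ w₁ w₂ N-eq refl refl refl refl = trans
  -- The rank is the same count with `w₁`, `w₂` as the dimensions, since -(r - w) is the distension.
  (kernel-count κ r₁ r₂ w₁ w₂ N-eq refl refl)
  (cong₂ (λ s t → + N ℤ.- + r₁ ℤ.- + r₂ ℤ.- + 2 ℤ.+ s ℤ.+ t)
    (excess (+ 1) (+ d₁) (+ w₁) (+ r₁)) (excess (+ 1) (+ d₂) (+ w₂) (+ r₂)))
  where
  excess : ∀ t d w r → ℤ.- (r ℤ.- w) ≡ d ℤ.+ t ℤ.+ w ℤ.- r ℤ.- t ℤ.- d
  excess = ℤ.solve-∀

theorem3 : (r₁ r₂ : ℕ) → 1 ≤ r₁ → 1 ≤ r₂ →
    (G₁ : Subgroup (GA r₁)) (G₂ : Subgroup (GA r₂)) →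
    (reg₁ : RegularSubgroup G₁) (reg₂ : RegularSubgroup G₂) →
    (T : Automorphism (Subgroup.group G₁)) (S : Automorphism (Subgroup.group G₂)) →
    (τ : F^ r₁ ↔ F^ r₁) (σ : F^ r₂ ↔ F^ r₂) →
    Induces G₁ reg₁ T τ → Induces G₂ reg₂ S σ →
    (l₁ l₂ k₁ k₂ : ℤ) →
    IsDistension τ l₁ → IsDistension σ l₂ →
    IsDeficiency τ k₁ → IsDeficiency σ k₂ →
    Propelinear (Sℋ (τ ∥ σ)) ×
    ExtendedPerfect (Sℋ (τ ∥ σ)) ×
    codeLength (Sℋ (τ ∥ σ)) ≡ 2 ^ (r₁ + r₂ + 1) ×
    (∃[ d ] HasRank (Sℋ (τ ∥ σ)) d ×
    + d ≡ + (2 ^ (r₁ + r₂ + 1)) ℤ.- + r₁ ℤ.- + r₂ ℤ.- + 2 ℤ.+ l₁ ℤ.+ l₂) ×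
    (∃[ d ] HasDimension (Ker (Sℋ (τ ∥ σ))) d ×
    + d ≡ + (2 ^ (r₁ + r₂ + 1)) ℤ.- + r₁ ℤ.- + r₂ ℤ.- + 2 ℤ.- k₁ ℤ.- k₂)
theorem3 r₁ r₂ _ _ G₁ G₂ reg₁ reg₂ T S τ σ τ-induced σ-induced l₁ l₂ k₁ k₂
         (d₁ , τ-dim , l₁-eq) (d₂ , σ-dim , l₂-eq) τ-def σ-def =
  let τ-affine               = induced-regularAffine G₁ reg₁ T τ τ-induced
      σ-affine               = induced-regularAffine G₂ reg₂ S σ σ-induced
      affine                 = ∥-regularAffine τ-affine σ-affine
      τ-𝟎                    = RegularAffine.ρ-𝟎 τ-affine
      σ-𝟎                    = RegularAffine.ρ-𝟎 σ-affine
      ρ-𝟎                    = RegularAffine.ρ-𝟎 affine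
      w₁ , τ-graph , w₁-eq   = Graph-dimension τ τ-𝟎 τ-dim
      w₂ , σ-graph , w₂-eq   = Graph-dimension σ σ-𝟎 σ-dim
      e₁ , τ-add , k₁-eq     = deficiency⇒dimension τ τ-𝟎 τ-def
      e₂ , σ-add , k₂-eq     = deficiency⇒dimension σ σ-𝟎 σ-def
      κ , ker-dim , κ-eq     = syndromes-kernel (r₁ + r₂)
      length-eq              = 2^[r+1]≡2^r+2^r (r₁ + r₂)
      N-eq                   = trans κ-eq (sym length-eq)
  in RegularAffine.Sℋ-propelinear affine ,
     Sℋ-extendedPerfect (τ ∥ σ) ,
     sym length-eq ,
     (κ + (w₁ + w₂) ,
      Sℋ-rank (τ ∥ σ) ρ-𝟎 ker-dim (Graph-dimension-∥ τ σ τ-𝟎 σ-𝟎 τ-graph σ-graph) ,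
      rank-count κ r₁ r₂ d₁ d₂ w₁ w₂ N-eq w₁-eq w₂-eq l₁-eq l₂-eq) ,
     (κ + (e₁ + e₂) ,
      Sℋ-Ker-dimension (τ ∥ σ) ρ-𝟎 ker-dim (HasDimension-resp (AdditiveAt-∥ τ σ) (dimension-× τ-add σ-add)) ,
      kernel-count κ r₁ r₂ e₁ e₂ N-eq k₁-eq k₂-eq)
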